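{- If $(\alpha,\beta)\in\{(1,1),(1,\omega),(\omega,1)\}$ and $(\gamma,\delta)\in\{(1,<\omega),(1,\omega|<\omega),(<\omega,1),(<\omega,\omega)\}$, then there is an elementary difference between $\mathcal D^\alpha_\beta$ and $\mathcal D^\gamma_\delta$ in the language of partial orderings $\{\le\}$; that is, some first-order sentence in the language $\{\le\}$ is true in one of them and false in the other.
   Context: Let $\{\Phi_e\}_{e\in\mathbb N}$ be an effective enumeration of all partial computable functions $\Phi_e:\subseteq\mathbb N^{\mathbb N}\to\mathbb N^{\mathbb N}$. A learner is a total computable function $\Psi:\mathbb N^{<\mathbb N}\to\mathbb N$; let $\{\Psi_e\}_{e\in\mathbb N}$ be an effective enumeration of all learners. A partial function $\Gamma:\subseteq\mathbb N^{\mathbb N}\to\mathbb N^{\mathbb N}$ is identified by $\Psi$ on $g$ if $\lim_n\Psi(g\upharpoonright n)$ exists and $\Phi_{\lim_n\Psi(g\upharpoonright n)}(g)=\Gamma(g)$, and is identified by $\Psi$ if this holds for every $g\in\mathrm{dom}(\Gamma)$. Then $\Gamma$ is: - $(1,1)$-computable if it is computable; - $(1,<\omega)$-computable if it is identified by a learner $\Psi$ with $\sup_{g\in\mathrm{dom}(\Gamma)}\#\{n:\Psi(g\upharpoonright (n+1))\neq\Psi(g\upharpoonright n)\}<\omega$; - $(1,\omega|<\omega)$-computable if it is identified by a learner $\Psi$ with $\sup_{g\in\mathrm{dom}(\Gamma)}\#\{\Psi(g\upharpoonright n):n\in\mathbb N\}<\omega$; - $(1,\omega)$-computable if it is identified by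 a learner; - $(<\omega,1)$-computable if there is $b\in\mathbb N$ such that for every $g\in\mathrm{dom}(\Gamma)$, $\Gamma(g)=\Phi_e(g)$ for some $e<b$; - $(<\omega,\omega)$-computable if there is $b\in\mathbb N$ such that for every $g\in\mathrm{dom}(\Gamma)$, $\Gamma$ is identified by $\Psi_e$ on $g$ for some $e<b$; - $(\omega,1)$-computable if $\Gamma(g)\le_Tg$ for every $g\in\mathrm{dom}(\Gamma)$. For each such notion $(\alpha,\beta)$ (where $\beta$ may be $\omega|<\omega$) and $A,B\subseteq\mathbb N^{\mathbb N}$, $A\le^\alpha_\beta B$ means there is an $(\alpha,\beta)$-computable $\Gamma$ with $B\subseteq\mathrm{dom}(\Gamma)$ and $\Gamma(g)\in A$ for every $g\in B$. $\mathcal D^\alpha_\beta$ is the partial order obtained by quotienting the set of all subsets of $\mathbb N^{\mathbb N}$, preordered by $\le^\alpha_\beta$, by the induced equivalence relation. -}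

module Defs where

open import Data.Fin.Base using (Fin)
open import Data.List.Base using (List; []; _∷_; length; applyUpTo)
open import Data.List.Membership.Propositional using (_∈_)
open import Data.Nat.Base using (ℕ; zero; suc; _+_; _≤_; _<_; z≤n; s≤s)
open import Data.Nat.Properties
  using (+-identityʳ; +-suc; suc-injective; <-cmp; ≤-refl; ≤-trans; ≤-<-trans; m≤m+n; m≤n+m)
open import Data.Product.Base using (_×_; _,_; ∃; ∃-syntax; Σ-syntax; proj₁; proj₂)
open import Data.Sum.Base using (_⊎_)
import Data.Vec.Functional as Vector
open import Data.Empty.Polymorphic using (⊥)
open import Function.Bundles using (_⇔_)
open import Level using (Level; 0ℓ) renaming (suc to lsuc)
open import Relation.Binary.Bundles.Raw using (RawRelation)
open import Relation.Binary.Construct.Interior.Symmetric using (SymInterior)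
open import Relation.Binary.Core using (Rel)
open import Relation.Binary.Definitions using (_Respects₂_; _Respects_; tri<; tri≈; tri>)
open import Relation.Binary.PropositionalEquality
open import Relation.Nullary.Negation.Core using (¬_; contradiction)
open import Relation.Unary using (Pred)

triangle : ℕ → ℕ
triangle zero    = 0
triangle (suc n) = suc (triangle n + n)

⟨_,_⟩ : ℕ → ℕ → ℕ
⟨ a , b ⟩ = triangle (a + b) + b

nextPair : ℕ × ℕ → ℕ × ℕ
nextPair (zero  , b) = suc b , 0
nextPair (suc a , b) = a , suc b

unpair : ℕ → ℕ × ℕ
unpair zero    = 0 , 0
unpair (suc n) = nextPair (unpair n)

π₁ π₂ : ℕ → ℕ
π₁ n = proj₁ (unpair n)
π₂ n = proj₂ (unpair n)

unpair-pair : ∀ a b → unpair ⟨ a , b ⟩ ≡ (a , b)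
unpair-pair a b = go (a + b) a b refl
  where
  go : ∀ s a b → a + b ≡ s → unpair (triangle s + b) ≡ (a , b)
  go zero    zero    zero    _  = refl
  go (suc s) (suc a) zero    eq = begin
    nextPair (unpair (triangle s + s + 0)) ≡⟨ cong (λ n → nextPair (unpair n)) (+-identityʳ (triangle s + s)) ⟩
    nextPair (unpair (triangle s + s))     ≡⟨ cong nextPair (go s 0 s refl) ⟩
    suc s , 0                              ≡⟨ cong (_, 0) (trans (sym eq) (+-identityʳ (suc a))) ⟩
    suc a , 0                              ∎
    where open ≡-Reasoning
  go (suc s) a       (suc b) eq = begin
    nextPair (unpair (triangle s + s + suc b))   ≡⟨ cong (λ n → nextPair (unpair n)) (+-suc (triangle s + s) b) ⟩
    nextPair (unpair (triangle (suc s) + b))     ≡⟨ cong nextPair (go (suc s) (suc a) b (trans (sym (+-suc a b)) eq)) ⟩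
    a , suc b                                    ∎
    where open ≡-Reasoning

encodeString : List ℕ → ℕ
encodeString []      = 0
encodeString (x ∷ σ) = suc ⟨ x , encodeString σ ⟩

Baire : Set
Baire = ℕ → ℕ

-- Programs for unary functions; several arguments are passed as one
-- number by means of the pairing function.
data Code : Set where
  zero succ fst snd oracle : Code
  pair comp prec           : Code → Code → Code
  mu                       : Code → Code

infix 4 _⊢_·_⇓_

-- g ⊢ c · n ⇓ m : with oracle g, program c halts on input n with output m.
data _⊢_·_⇓_ (g : Baire) : Code → ℕ → ℕ → Set where
  zero   : ∀ {n} → g ⊢ zero · n ⇓ 0
  succ   : ∀ {n} → g ⊢ succ · n ⇓ suc n
  fst    : ∀ {n} → g ⊢ fst · n ⇓ π₁ n
  snd    : ∀ {n} → g ⊢ snd · n ⇓ π₂ n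
  oracle : ∀ {n} → g ⊢ oracle · n ⇓ g n
  pair   : ∀ {c d n a b} → g ⊢ c · n ⇓ a → g ⊢ d · n ⇓ b →
           g ⊢ pair c d · n ⇓ ⟨ a , b ⟩
  comp   : ∀ {c d n k m} → g ⊢ d · n ⇓ k → g ⊢ c · k ⇓ m →
           g ⊢ comp c d · n ⇓ m
  -- h⟨x,0⟩ = c(x)  and  h⟨x,k+1⟩ = d⟨x,⟨k,h⟨x,k⟩⟩⟩
  prec-zero : ∀ {c d n m} → π₂ n ≡ 0 → g ⊢ c · π₁ n ⇓ m →
              g ⊢ prec c d · n ⇓ m
  prec-suc  : ∀ {c d n k r m} → π₂ n ≡ suc k →
              g ⊢ prec c d · ⟨ π₁ n , k ⟩ ⇓ r →
              g ⊢ d · ⟨ π₁ n , ⟨ k , r ⟩ ⟩ ⇓ m →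
              g ⊢ prec c d · n ⇓ m
  -- The least m with c⟨n,m⟩ = 0, where c⟨n,i⟩ must halt for all i < m.
  mu     : ∀ {c n m} (v : ℕ → ℕ) →
           (∀ i → i < m → g ⊢ c · ⟨ n , i ⟩ ⇓ suc (v i)) →
           g ⊢ c · ⟨ n , m ⟩ ⇓ 0 →
           g ⊢ mu c · n ⇓ m

⇓-deterministic : ∀ {g h c n m m′} → g ≗ h →
                  g ⊢ c · n ⇓ m → h ⊢ c · n ⇓ m′ → m ≡ m′
⇓-deterministic e zero zero = refl
⇓-deterministic e succ succ = refl
⇓-deterministic e fst fst = refl
⇓-deterministic e snd snd = refl
⇓-deterministic e oracle oracle = e _
⇓-deterministic e (pair p q) (pair p′ q′) =
  cong₂ ⟨_,_⟩ (⇓-deterministic e p p′) (⇓-deterministic e q q′)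
⇓-deterministic e (comp p q) (comp p′ q′)
  with refl ← ⇓-deterministic e p p′ = ⇓-deterministic e q q′
⇓-deterministic e (prec-zero _ p) (prec-zero _ p′) = ⇓-deterministic e p p′
⇓-deterministic e (prec-zero z _) (prec-suc s _ _) = contradiction (trans (sym z) s) λ ()
⇓-deterministic e (prec-suc s _ _) (prec-zero z _) = contradiction (trans (sym z) s) λ ()
⇓-deterministic e (prec-suc s p q) (prec-suc s′ p′ q′)
  with refl ← suc-injective (trans (sym s) s′)
  with refl ← ⇓-deterministic e p p′ = ⇓-deterministic e q q′
⇓-deterministic {m = m} {m′} e (mu v p q) (mu v′ p′ q′) with <-cmp m m′
... | tri< m<m′ _ _ = contradiction (⇓-deterministic e q (p′ m m<m′)) λ ()
... | tri≈ _ m≡m′ _ = m≡m′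
... | tri> _ _ m′<m = contradiction (⇓-deterministic e (p m′ m′<m) q′) λ ()

⇓-resp-≗ : ∀ {g h c n m} → g ≗ h → g ⊢ c · n ⇓ m → h ⊢ c · n ⇓ m
⇓-resp-≗ e zero = zero
⇓-resp-≗ e succ = succ
⇓-resp-≗ e fst = fst
⇓-resp-≗ e snd = snd
⇓-resp-≗ {h = h} e (oracle {n}) = subst (h ⊢ oracle · n ⇓_) (sym (e n)) oracle
⇓-resp-≗ e (pair p q) = pair (⇓-resp-≗ e p) (⇓-resp-≗ e q)
⇓-resp-≗ e (comp p q) = comp (⇓-resp-≗ e p) (⇓-resp-≗ e q)
⇓-resp-≗ e (prec-zero z p) = prec-zero z (⇓-resp-≗ e p)
⇓-resp-≗ e (prec-suc s p q) = prec-suc s (⇓-resp-≗ e p) (⇓-resp-≗ e q)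
⇓-resp-≗ e (mu v p q) = mu v (λ i i<m → ⇓-resp-≗ e (p i i<m)) (⇓-resp-≗ e q)

encode : Code → ℕ
encode zero       = ⟨ 0 , 0 ⟩
encode succ       = ⟨ 1 , 0 ⟩
encode fst        = ⟨ 2 , 0 ⟩
encode snd        = ⟨ 3 , 0 ⟩
encode oracle     = ⟨ 4 , 0 ⟩
encode (pair c d) = ⟨ 5 , ⟨ encode c , encode d ⟩ ⟩
encode (comp c d) = ⟨ 6 , ⟨ encode c , encode d ⟩ ⟩
encode (prec c d) = ⟨ 7 , ⟨ encode c , encode d ⟩ ⟩
encode (mu c)     = ⟨ 8 , encode c ⟩

decodeNode : (ℕ → Code) → ℕ × ℕ → Code
decodeNode rec (0 , _) = zero
decodeNode rec (1 , _) = succ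
decodeNode rec (2 , _) = fst
decodeNode rec (3 , _) = snd
decodeNode rec (4 , _) = oracle
decodeNode rec (5 , p) = pair (rec (π₁ p)) (rec (π₂ p))
decodeNode rec (6 , p) = comp (rec (π₁ p)) (rec (π₂ p))
decodeNode rec (7 , p) = prec (rec (π₁ p)) (rec (π₂ p))
decodeNode rec (_ , p) = mu (rec p)

-- The first argument bounds the recursion depth.  Every recursive call
-- is at a smaller number, so in decode the bound is never reached.
decodeWithin : ℕ → ℕ → Code
decodeWithin zero       _ = zero
decodeWithin (suc fuel) e = decodeNode (decodeWithin fuel) (unpair e)

decode : ℕ → Code
decode e = decodeWithin (suc e) e

private
  n≤triangle : ∀ n → n ≤ triangle n
  n≤triangle zero    = z≤n
  n≤triangle (suc n) = s≤s (m≤n+m n (triangle n))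

  fst≤ : ∀ a b → a ≤ ⟨ a , b ⟩
  fst≤ a b = ≤-trans (m≤m+n a b) (≤-trans (n≤triangle (a + b)) (m≤m+n _ b))

  snd≤ : ∀ a b → b ≤ ⟨ a , b ⟩
  snd≤ a b = m≤n+m b _

  snd< : ∀ a b → b < ⟨ suc a , b ⟩
  snd< a b = s≤s (m≤n+m b _)

  within₁ : ∀ t a b {k} → ⟨ suc t , ⟨ a , b ⟩ ⟩ < suc k → a < k
  within₁ t a b (s≤s le) = ≤-trans (≤-<-trans (fst≤ a b) (snd< t ⟨ a , b ⟩)) le

  within₂ : ∀ t a b {k} → ⟨ suc t , ⟨ a , b ⟩ ⟩ < suc k → b < k
  within₂ t a b (s≤s le) = ≤-trans (≤-<-trans (snd≤ a b) (snd< t ⟨ a , b ⟩)) le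

  go : ∀ k c → encode c < k → decodeWithin k (encode c) ≡ c
  go (suc k) zero       _ = refl
  go (suc k) succ       _ = refl
  go (suc k) fst        _ = refl
  go (suc k) snd        _ = refl
  go (suc k) oracle     _ = refl
  go (suc k) (pair c d) l
    rewrite unpair-pair 5 ⟨ encode c , encode d ⟩ | unpair-pair (encode c) (encode d) =
    cong₂ pair (go k c (within₁ 4 _ (encode d) l)) (go k d (within₂ 4 (encode c) _ l))
  go (suc k) (comp c d) l
    rewrite unpair-pair 6 ⟨ encode c , encode d ⟩ | unpair-pair (encode c) (encode d) =
    cong₂ comp (go k c (within₁ 5 _ (encode d) l)) (go k d (within₂ 5 (encode c) _ l))
  go (suc k) (prec c d) l
    rewrite unpair-pair 7 ⟨ encode c , encode d ⟩ | unpair-pair (encode c) (encode d) =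
    cong₂ prec (go k c (within₁ 6 _ (encode d) l)) (go k d (within₂ 6 (encode c) _ l))
  go (suc k) (mu c) (s≤s l)
    rewrite unpair-pair 8 (encode c) =
    cong mu (go k c (≤-trans (snd< 7 (encode c)) l))

decode-encode : ∀ c → decode (encode c) ≡ c
decode-encode c = go (suc (encode c)) c ≤-refl

-- Functions ℕ → ℕ are identified when pointwise equal, so graphs, and
-- below subsets, are required to respect _≗_.
record PartialFunction : Set₁ where
  infix 4 _↦_
  field
    _↦_        : Rel Baire 0ℓ
    functional : ∀ {g f f′} → g ↦ f → g ↦ f′ → f ≗ f′
    respects   : _↦_ Respects₂ _≗_

  Dom : Pred Baire 0ℓ
  Dom g = ∃[ f ] g ↦ f

infix 4 _at_↦_
_at_↦_ : PartialFunction → Baire → Baire → Set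
Γ at g ↦ f = PartialFunction._↦_ Γ g f

open PartialFunction public using (Dom)

-- Equality of values of partial functions: both undefined, or both
-- defined and equal.
infix 4 _≃_at_
_≃_at_ : PartialFunction → PartialFunction → Baire → Set
Γ ≃ Δ at g = ∀ f → (Γ at g ↦ f) ⇔ (Δ at g ↦ f)

Φ : ℕ → PartialFunction
Φ e = record
  { _↦_        = λ g f → ∀ n → g ⊢ decode e · n ⇓ f n
  ; functional = λ p q n → ⇓-deterministic (λ _ → refl) (p n) (q n)
  ; respects   = (λ {g} f≗f′ p n → subst (g ⊢ decode e · n ⇓_) (f≗f′ n) (p n))
               , (λ g≗g′ p n → ⇓-resp-≗ g≗g′ (p n))
  }

infix 4 _≤ᵀ_
_≤ᵀ_ : Rel Baire 0ℓ
f ≤ᵀ g = ∃[ e ] Φ e at g ↦ f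

-- ψ is the (total) function ℕ^<ℕ → ℕ computed by program number e,
-- run with a trivial oracle.
_computes_ : ℕ → (List ℕ → ℕ) → Set
e computes ψ = ∀ σ → (λ _ → 0) ⊢ decode e · encodeString σ ⇓ ψ σ

Learner : (List ℕ → ℕ) → Set
Learner ψ = ∃[ e ] e computes ψ

_↾_ : Baire → ℕ → List ℕ
g ↾ n = applyUpTo g n

_convergesTo_ : (ℕ → ℕ) → ℕ → Set
s convergesTo d = ∃[ N ] (∀ n → N ≤ n → s n ≡ d)

_identifies_on_ : (List ℕ → ℕ) → PartialFunction → Baire → Set
ψ identifies Γ on g =
  ∃[ d ] ((λ n → ψ (g ↾ n)) convergesTo d × (Φ d ≃ Γ at g))

_identifies_ : (List ℕ → ℕ) → PartialFunction → Set
ψ identifies Γ = ∀ g → Dom Γ g → ψ identifies Γ on g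

#_≤_ : Pred ℕ 0ℓ → ℕ → Set
# P ≤ k = Σ[ xs ∈ List ℕ ] (length xs ≤ k × (∀ n → P n → n ∈ xs))

MindChange : (List ℕ → ℕ) → Baire → Pred ℕ 0ℓ
MindChange ψ g n = ψ (g ↾ suc n) ≢ ψ (g ↾ n)

Guess : (List ℕ → ℕ) → Baire → Pred ℕ 0ℓ
Guess ψ g d = ∃[ n ] ψ (g ↾ n) ≡ d

data Notion : Set where
  ⟨1,1⟩ ⟨1,<ω⟩ ⟨1,ω|<ω⟩ ⟨1,ω⟩ ⟨<ω,1⟩ ⟨<ω,ω⟩ ⟨ω,1⟩ : Notion

-- In the ⟨<ω,ω⟩ case the e-th learner is the function computed by
-- program number e, for those e whose program is total on strings.  Any
-- enumeration of the learners gives the same notion: only the finiteness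
-- of the set of learners with number below b matters.
_-computable_ : Notion → PartialFunction → Set
⟨1,1⟩    -computable Γ = ∃[ e ] (∀ g → Γ ≃ Φ e at g)
⟨1,<ω⟩   -computable Γ = ∃[ ψ ] (Learner ψ × ψ identifies Γ ×
                           (∃[ k ] (∀ g → Dom Γ g → # MindChange ψ g ≤ k)))
⟨1,ω|<ω⟩ -computable Γ = ∃[ ψ ] (Learner ψ × ψ identifies Γ ×
                           (∃[ k ] (∀ g → Dom Γ g → # Guess ψ g ≤ k)))
⟨1,ω⟩    -computable Γ = ∃[ ψ ] (Learner ψ × ψ identifies Γ)
⟨<ω,1⟩   -computable Γ = ∃[ b ] (∀ g → Dom Γ g → ∃[ e ] (e < b × (Γ ≃ Φ e at g)))
⟨<ω,ω⟩   -computable Γ = ∃[ b ] (∀ g → Dom Γ g →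
                           ∃[ e ] (e < b × (∃[ ψ ] (e computes ψ × ψ identifies Γ on g))))
⟨ω,1⟩    -computable Γ = ∀ g f → Γ at g ↦ f → f ≤ᵀ g

record Subset : Set₁ where
  field
    Member   : Pred Baire 0ℓ
    respects : Member Respects _≗_

infix 4 _∈ˢ_
_∈ˢ_ : Baire → Subset → Set
g ∈ˢ A = Subset.Member A g

infix 4 _≤[_]_
_≤[_]_ : Subset → Notion → Subset → Set₁
A ≤[ ν ] B = Σ[ Γ ∈ PartialFunction ]
  (ν -computable Γ ×
   (∀ g → g ∈ˢ B → Dom Γ g) ×
   (∀ g f → g ∈ˢ B → Γ at g ↦ f → f ∈ˢ A))

-- The quotient is the setoid whose equality is mutual reducibility.
𝓓 : Notion → RawRelation (lsuc 0ℓ) (lsuc 0ℓ) (lsuc 0ℓ)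
𝓓 ν = record
  { Carrier = Subset
  ; _≈_     = SymInterior (_≤[ ν ]_)
  ; _∼_     = _≤[ ν ]_
  }

infix  8 _≼_ _≐_
infixr 7 _∧′_
infixr 6 _∨′_
infixr 5 _⇒′_

-- Formulas over one binary relation symbol and equality, with n free
-- variables.
data Formula (n : ℕ) : Set where
  _≼_ _≐_        : Fin n → Fin n → Formula n
  ⊥′             : Formula n
  ¬′_            : Formula n → Formula n
  _∧′_ _∨′_ _⇒′_ : Formula n → Formula n → Formula n
  ∀′_ ∃′_        : Formula (suc n) → Formula n

Sentence : Set
Sentence = Formula 0

module _ {ℓ : Level} (M : RawRelation ℓ ℓ ℓ) where
  open RawRelation M

  -- Tarskian truth, which is classical once the metatheory has excluded
  -- middle.  The innermost bound variable has index zero.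
  Holds : ∀ {n} → Formula n → Vector.Vector Carrier n → Set ℓ
  Holds (i ≼ j)  ρ = ρ i ∼ ρ j
  Holds (i ≐ j)  ρ = ρ i ≈ ρ j
  Holds ⊥′       ρ = ⊥
  Holds (¬′ φ)   ρ = ¬ Holds φ ρ
  Holds (φ ∧′ χ) ρ = Holds φ ρ × Holds χ ρ
  Holds (φ ∨′ χ) ρ = Holds φ ρ ⊎ Holds χ ρ
  Holds (φ ⇒′ χ) ρ = Holds φ ρ → Holds χ ρ
  Holds (∀′ φ)   ρ = ∀ x → Holds φ (x Vector.∷ ρ)
  Holds (∃′ φ)   ρ = ∃[ x ] Holds φ (x Vector.∷ ρ)

infix 4 _⊨_
_⊨_ : ∀ {ℓ} → RawRelation ℓ ℓ ℓ → Sentence → Set ℓ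
M ⊨ φ = Holds M φ Vector.[]

ElementarilyDifferent : ∀ {ℓ} → RawRelation ℓ ℓ ℓ → RawRelation ℓ ℓ ℓ → Set ℓ
ElementarilyDifferent M N =
  ∃[ φ ] ((M ⊨ φ × ¬ (N ⊨ φ)) ⊎ (¬ (M ⊨ φ) × N ⊨ φ))

{-# OPTIONS --safe #-}

-- The degrees for (1,1), (1,ω) and (ω,1) are Brouwerian: among the C with
-- B ≤ A ⊕ C there is a least one, consisting of the reals g together with a
-- realizer that solves B from f ⊕ g for every f in A.  For (1,ω) this rests on
-- the composition of learners, which runs guessed programs for a bounded number
-- of steps.
--
-- The other four structures are not.  There are A, B and reals g 0, g 1, … such
-- that B ≤ A ⊕ {g m} for every m, but with a nonuniformity that grows with m.
-- A least C would have a member computable from g m for each m, and the single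
-- bound of the reduction B ≤ A ⊕ C would then serve all m.

module Submission where

open import Defs
open import Axiom.ExcludedMiddle using (ExcludedMiddle)
open import Data.Empty using (⊥)
open import Data.Fin.Base using (Fin; zero; suc; toℕ; fromℕ<)
open import Data.Fin.Properties using (pigeonhole; toℕ<n; toℕ-fromℕ<)
open import Data.List.Base using (List; []; _∷_; length; applyUpTo; _++_; map; cartesianProductWith)
import Data.List.Base as List
open import Data.List.Membership.Propositional using (_∈_)
open import Data.List.Membership.Propositional.Properties
  using (∈-++⁺ˡ; ∈-++⁺ʳ; ∈-cartesianProductWith⁺; ∈-map⁺; ∈-applyUpTo⁺)
open import Data.List.Properties using (length-++; length-map; length-applyUpTo)
open import Data.List.Relation.Unary.Any using (here; there)
import Data.List.Relation.Unary.Any as Any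
open import Data.List.Relation.Unary.Any.Properties using (lookup-index)
open import Data.Nat.Base
open import Data.Nat.Properties
open import Data.Product.Base using (_×_; _,_; ∃-syntax; proj₁; proj₂)
open import Data.Sum.Base using (_⊎_; inj₁; inj₂)
open import Data.Vec.Base using (Vec; []; _∷_; lookup)
open import Function.Base using (_∘_)
open import Function.Bundles using (mk⇔; module Equivalence)
open import Level using (0ℓ; Lift; lift; lower) renaming (suc to lsuc)
open import Relation.Binary.Definitions using (tri<; tri≈; tri>)
open import Relation.Binary.PropositionalEquality hiding ([_])
open import Relation.Nullary using (¬_; contradiction; Dec; yes; no)
open import Relation.Nullary.Decidable using (map′; decidable-stable)

-- Pairing and codes

-- A residual stores a realizer but cannot bound it: for the four bounded notions the stored
-- realizers would need all bounds at once, and the counterexamples exploit this. A solution there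
-- names a pair (i, m) through the reals `u i` and `g m` and carries the tag `ρ i ⊓ m`. Independence
-- of the reals forces whoever works from `u i` and `g m` to output the tag of exactly this pair.
-- The cap makes each single `g m` easy, since only the tags up to m occur; against a given bound
-- one takes m so large that the cap has no effect on the tags that matter. What ρ may be depends on
-- the notion. With finitely many programs or learners the right one may be picked nonuniformly for
-- each i, so ρ may be an arbitrary diagonal function, obtained by pigeonhole. A single learner with
-- boundedly many changes or guesses has to find the tag by itself; therefore the members of A carry
-- a label that can rise finitely often, and ρ is the identity.

-- Opaque copies of the pairing functions: on open terms the transparent
-- ones unfold into large normal forms.
opaque
  _⊗_ : ℕ → ℕ → ℕ
  a ⊗ b = ⟨ a , b ⟩

  p₁ p₂ : ℕ → ℕ
  p₁ n = π₁ n
  p₂ n = π₂ n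

  ⊗≡⟨,⟩ : ∀ a b → a ⊗ b ≡ ⟨ a , b ⟩
  ⊗≡⟨,⟩ a b = refl

  p₁≡π₁ : ∀ n → p₁ n ≡ π₁ n
  p₁≡π₁ n = refl

  p₂≡π₂ : ∀ n → p₂ n ≡ π₂ n
  p₂≡π₂ n = refl

  p₁-⊗ : ∀ a b → p₁ (a ⊗ b) ≡ a
  p₁-⊗ a b = cong proj₁ (unpair-pair a b)

  p₂-⊗ : ∀ a b → p₂ (a ⊗ b) ≡ b
  p₂-⊗ a b = cong proj₂ (unpair-pair a b)

infixr 6 _⊗_

p₁-⟨,⟩ : ∀ a b → p₁ ⟨ a , b ⟩ ≡ a
p₁-⟨,⟩ a b = trans (cong p₁ (sym (⊗≡⟨,⟩ a b))) (p₁-⊗ a b)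

p₂-⟨,⟩ : ∀ a b → p₂ ⟨ a , b ⟩ ≡ b
p₂-⟨,⟩ a b = trans (cong p₂ (sym (⊗≡⟨,⟩ a b))) (p₂-⊗ a b)

⊗-injective : ∀ {a b c d} → a ⊗ b ≡ c ⊗ d → a ≡ c × b ≡ d
⊗-injective {a} {b} {c} {d} eq =
  trans (sym (p₁-⊗ a b)) (trans (cong p₁ eq) (p₁-⊗ c d)) ,
  trans (sym (p₂-⊗ a b)) (trans (cong p₂ eq) (p₂-⊗ c d))

⟨nextPair⟩ : ∀ p → ⟨ proj₁ (nextPair p) , proj₂ (nextPair p) ⟩ ≡ suc ⟨ proj₁ p , proj₂ p ⟩
⟨nextPair⟩ (zero , b) = begin
  suc (triangle (b + 0) + (b + 0)) + 0 ≡⟨ +-identityʳ _ ⟩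
  suc (triangle (b + 0) + (b + 0))     ≡⟨ cong (λ t → suc (triangle t + t)) (+-identityʳ b) ⟩
  suc (triangle b + b)                 ∎
  where open ≡-Reasoning
⟨nextPair⟩ (suc a , b) = begin
  triangle (a + suc b) + suc b ≡⟨ cong (λ t → triangle t + suc b) (+-suc a b) ⟩
  triangle (suc a + b) + suc b ≡⟨ +-suc _ b ⟩
  suc (triangle (suc a + b) + b) ∎
  where open ≡-Reasoning

pair-unpair : ∀ n → ⟨ π₁ n , π₂ n ⟩ ≡ n
pair-unpair zero    = refl
pair-unpair (suc n) = trans (⟨nextPair⟩ (unpair n)) (cong suc (pair-unpair n))

n≤triangle : ∀ n → n ≤ triangle n
n≤triangle zero    = z≤n
n≤triangle (suc n) = s≤s (m≤n+m n (triangle n))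

fst≤pair : ∀ a b → a ≤ ⟨ a , b ⟩
fst≤pair a b = ≤-trans (m≤m+n a b) (≤-trans (n≤triangle (a + b)) (m≤m+n _ b))

snd≤pair : ∀ a b → b ≤ ⟨ a , b ⟩
snd≤pair a b = m≤n+m b _

⊗-≥ʳ : ∀ a b → b ≤ a ⊗ b
⊗-≥ʳ a b = subst (b ≤_) (sym (⊗≡⟨,⟩ a b)) (snd≤pair a b)

decodeNode-cong : ∀ (r r′ : ℕ → Code) p → (∀ x → x < ⟨ proj₁ p , proj₂ p ⟩ → r x ≡ r′ x) →
                  decodeNode r p ≡ decodeNode r′ p
decodeNode-cong r r′ (0 , p) eq = refl
decodeNode-cong r r′ (1 , p) eq = refl
decodeNode-cong r r′ (2 , p) eq = refl
decodeNode-cong r r′ (3 , p) eq = refl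
decodeNode-cong r r′ (4 , p) eq = refl
decodeNode-cong r r′ (suc (suc (suc (suc (suc t)))) , p) eq = go t p eq
  where
  p<⟨⟩ : ∀ t p → p < ⟨ suc t , p ⟩
  p<⟨⟩ t p = s≤s (m≤n+m p _)
  π₁≤ : ∀ p → π₁ p ≤ p
  π₁≤ p = subst (π₁ p ≤_) (pair-unpair p) (fst≤pair (π₁ p) (π₂ p))
  π₂≤ : ∀ p → π₂ p ≤ p
  π₂≤ p = subst (π₂ p ≤_) (pair-unpair p) (snd≤pair (π₁ p) (π₂ p))
  go : ∀ t p → (∀ x → x < ⟨ 5 + t , p ⟩ → r x ≡ r′ x) →
       decodeNode r (5 + t , p) ≡ decodeNode r′ (5 + t , p)
  go 0 p eq = cong₂ pair (eq _ (≤-<-trans (π₁≤ p) (p<⟨⟩ 4 p))) (eq _ (≤-<-trans (π₂≤ p) (p<⟨⟩ 4 p)))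
  go 1 p eq = cong₂ comp (eq _ (≤-<-trans (π₁≤ p) (p<⟨⟩ 5 p))) (eq _ (≤-<-trans (π₂≤ p) (p<⟨⟩ 5 p)))
  go 2 p eq = cong₂ prec (eq _ (≤-<-trans (π₁≤ p) (p<⟨⟩ 6 p))) (eq _ (≤-<-trans (π₂≤ p) (p<⟨⟩ 6 p)))
  go (suc (suc (suc t))) p eq = cong mu (eq p (p<⟨⟩ (7 + t) p))

decodeWithin-fuel : ∀ k l d → d < k → d < l → decodeWithin k d ≡ decodeWithin l d
decodeWithin-fuel (suc k) (suc l) d d<k d<l =
  decodeNode-cong _ _ (unpair d) λ x x<d →
    let x<d′ = subst (x <_) (pair-unpair d) x<d in
    decodeWithin-fuel k l x (<-≤-trans x<d′ (s≤s⁻¹ d<k)) (<-≤-trans x<d′ (s≤s⁻¹ d<l))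

-- The arguments of a node are smaller than its number, so all sufficient fuels agree. The universal
-- machine can thus interpret arbitrary numbers, not only values of `encode`.
decode-unfold : ∀ e → decode e ≡ decodeNode decode (p₁ e , p₂ e)
decode-unfold e rewrite p₁≡π₁ e | p₂≡π₂ e =
  decodeNode-cong _ _ (unpair e) λ x x<e →
    decodeWithin-fuel e (suc x) x (subst (x <_) (pair-unpair e) x<e) ≤-refl

-- Compiling primitive recursive expressions to programs

natrec : {A : Set} → A → (ℕ → A → A) → ℕ → A
natrec z s zero    = z
natrec z s (suc n) = s n (natrec z s n)

-- Expressions for functionals that are primitive recursive in the oracle.
-- In the step of rec, variable 0 is the counter and variable 1 the
-- previous value.
data Exp : ℕ → Set where
  var         : ∀ {n} → Fin n → Exp n
  ze          : ∀ {n} → Exp n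
  su ft sd orc : ∀ {n} → Exp n → Exp n
  _⊗ᵉ_ _∸ᵉ_   : ∀ {n} → Exp n → Exp n → Exp n
  ifz         : ∀ {n} → Exp n → Exp n → Exp n → Exp n
  lt          : ∀ {n} → Exp n → Exp (suc n) → Exp n
  rec         : ∀ {n} → Exp n → Exp n → Exp (2 + n) → Exp n

infixr 6 _⊗ᵉ_
infixl 6 _∸ᵉ_

eval : ∀ {n} → Exp n → Baire → Vec ℕ n → ℕ
eval (var i)     g ρ = lookup ρ i
eval ze          g ρ = 0
eval (su e)      g ρ = suc (eval e g ρ)
eval (ft e)      g ρ = p₁ (eval e g ρ)
eval (sd e)      g ρ = p₂ (eval e g ρ)
eval (orc e)     g ρ = g (eval e g ρ)
eval (e ⊗ᵉ e′)   g ρ = eval e g ρ ⊗ eval e′ g ρ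
eval (e ∸ᵉ e′)   g ρ = eval e g ρ ∸ eval e′ g ρ
eval (ifz c a b) g ρ = natrec (eval a g ρ) (λ _ _ → eval b g ρ) (eval c g ρ)
eval (lt e b)    g ρ = eval b g (eval e g ρ ∷ ρ)
eval (rec e z s) g ρ = natrec (eval z g ρ) (λ k r → eval s g (k ∷ r ∷ ρ)) (eval e g ρ)

env : ∀ {n} → Vec ℕ n → ℕ
env []      = 0
env (x ∷ ρ) = x ⊗ env ρ

idc : Code
idc = pair fst snd

varc : ∀ {n} → Fin n → Code
varc zero    = fst
varc (suc i) = comp (varc i) snd

prdc : Code
prdc = comp (prec zero (comp fst snd)) (pair zero idc)

compile : ∀ {n} → Exp n → Code
compile (var i)     = varc i
compile ze          = zero
compile (su e)      = comp succ (compile e)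
compile (ft e)      = comp fst (compile e)
compile (sd e)      = comp snd (compile e)
compile (orc e)     = comp oracle (compile e)
compile (e ⊗ᵉ e′)   = pair (compile e) (compile e′)
compile (e ∸ᵉ e′)   = comp (prec (compile e) (comp prdc (comp snd snd))) (pair idc (compile e′))
-- Case distinction is a recursion whose step ignores counter and previous value; expressions are
-- total, so repeating the step is harmless.
compile (ifz c a b) = comp (prec (compile a) (comp (compile b) fst)) (pair idc (compile c))
compile (lt e b)    = comp (compile b) (pair (compile e) idc)
compile (rec e z s) =
  comp (prec (compile z) (comp (compile s) (pair (comp fst snd) (pair (comp snd snd) fst))))
       (pair idc (compile e))

-- Codes receive a bare number, environments are terminated by 0.
fn : Exp 1 → Code
fn e = comp (compile e) (pair idc zero)

module _ {g : Baire} where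

  ⇓≡ : ∀ {c n m m′} → g ⊢ c · n ⇓ m → m ≡ m′ → g ⊢ c · n ⇓ m′
  ⇓≡ p refl = p

  fst⇓ : ∀ {a b} → g ⊢ fst · a ⊗ b ⇓ a
  fst⇓ {a} {b} = ⇓≡ fst (trans (sym (p₁≡π₁ _)) (p₁-⊗ a b))

  snd⇓ : ∀ {a b} → g ⊢ snd · a ⊗ b ⇓ b
  snd⇓ {a} {b} = ⇓≡ snd (trans (sym (p₂≡π₂ _)) (p₂-⊗ a b))

  ft⇓ : ∀ {n} → g ⊢ fst · n ⇓ p₁ n
  ft⇓ {n} = ⇓≡ fst (sym (p₁≡π₁ n))

  sd⇓ : ∀ {n} → g ⊢ snd · n ⇓ p₂ n
  sd⇓ {n} = ⇓≡ snd (sym (p₂≡π₂ n))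

  pair⇓ : ∀ {c d n a b} → g ⊢ c · n ⇓ a → g ⊢ d · n ⇓ b → g ⊢ pair c d · n ⇓ a ⊗ b
  pair⇓ {a = a} {b} p q = ⇓≡ (pair p q) (sym (⊗≡⟨,⟩ a b))

  id⇓ : ∀ {n} → g ⊢ idc · n ⇓ n
  id⇓ {n} = ⇓≡ (pair fst snd) (pair-unpair n)

  prec⇓ : ∀ {c d x z} {s : ℕ → ℕ → ℕ} → g ⊢ c · x ⇓ z →
          (∀ k r → g ⊢ d · x ⊗ (k ⊗ r) ⇓ s k r) →
          ∀ k → g ⊢ prec c d · x ⊗ k ⇓ natrec z s k
  prec⇓ {c} {d} {x} {z} {s} hz hs zero =
    prec-zero (trans (sym (p₂≡π₂ _)) (p₂-⊗ x 0))
              (subst (g ⊢ c ·_⇓ z) (sym (trans (sym (p₁≡π₁ _)) (p₁-⊗ x 0))) hz)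
  prec⇓ {c} {d} {x} {z} {s} hz hs (suc k) =
    prec-suc {r = natrec z s k} (trans (sym (p₂≡π₂ _)) (p₂-⊗ x (suc k)))
      (subst (λ t → g ⊢ prec c d · t ⇓ natrec z s k) (lem k) (prec⇓ hz hs k))
      (subst (λ t → g ⊢ d · t ⇓ natrec z s (suc k))
        (trans (lem _) (cong (λ t → ⟨ π₁ (x ⊗ suc k) , t ⟩) (⊗≡⟨,⟩ k _))) (hs k (natrec z s k)))
    where
    lem : ∀ t → x ⊗ t ≡ ⟨ π₁ (x ⊗ suc k) , t ⟩
    lem t = trans (⊗≡⟨,⟩ x t) (cong (λ y → ⟨ y , t ⟩) (sym (trans (sym (p₁≡π₁ _)) (p₁-⊗ x (suc k)))))

  prd⇓ : ∀ {n} → g ⊢ prdc · n ⇓ pred n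
  prd⇓ {zero}  = comp (pair⇓ zero id⇓) (prec⇓ {s = λ k _ → k} zero (λ k r → comp snd⇓ fst⇓) 0)
  prd⇓ {suc n} = comp (pair⇓ zero id⇓) (prec⇓ {s = λ k _ → k} zero (λ k r → comp snd⇓ fst⇓) (suc n))

  var⇓ : ∀ {n} (i : Fin n) ρ → g ⊢ varc i · env ρ ⇓ lookup ρ i
  var⇓ zero    (x ∷ ρ) = fst⇓
  var⇓ (suc i) (x ∷ ρ) = comp snd⇓ (var⇓ i ρ)

  compile⇓ : ∀ {n} (e : Exp n) ρ → g ⊢ compile e · env ρ ⇓ eval e g ρ
  compile⇓ (var i)     ρ = var⇓ i ρ
  compile⇓ ze          ρ = zero
  compile⇓ (su e)      ρ = comp (compile⇓ e ρ) succ
  compile⇓ (ft e)      ρ = comp (compile⇓ e ρ) ft⇓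
  compile⇓ (sd e)      ρ = comp (compile⇓ e ρ) sd⇓
  compile⇓ (orc e)     ρ = comp (compile⇓ e ρ) oracle
  compile⇓ (e ⊗ᵉ e′)   ρ = pair⇓ (compile⇓ e ρ) (compile⇓ e′ ρ)
  compile⇓ (e ∸ᵉ e′)   ρ =
    comp (pair⇓ id⇓ (compile⇓ e′ ρ))
      (⇓≡ (prec⇓ {s = λ _ → pred} (compile⇓ e ρ) (λ k r → comp (comp snd⇓ snd⇓) prd⇓) (eval e′ g ρ))
          (natrec-pred (eval e′ g ρ)))
    where
    natrec-pred : ∀ k → natrec (eval e g ρ) (λ _ → pred) k ≡ eval e g ρ ∸ k
    natrec-pred zero    = refl
    natrec-pred (suc k) = trans (cong pred (natrec-pred k)) (pred[m∸n]≡m∸[1+n] (eval e g ρ) k)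
  compile⇓ (ifz c a b) ρ =
    comp (pair⇓ id⇓ (compile⇓ c ρ))
      (prec⇓ (compile⇓ a ρ) (λ k r → comp fst⇓ (compile⇓ b ρ)) (eval c g ρ))
  compile⇓ (lt e b)    ρ = comp (pair⇓ (compile⇓ e ρ) id⇓) (compile⇓ b (eval e g ρ ∷ ρ))
  compile⇓ (rec e z s) ρ =
    comp (pair⇓ id⇓ (compile⇓ e ρ))
      (prec⇓ (compile⇓ z ρ)
        (λ k r → comp (pair⇓ (comp snd⇓ fst⇓) (pair⇓ (comp snd⇓ snd⇓) fst⇓)) (compile⇓ s (k ∷ r ∷ ρ)))
        (eval e g ρ))

  fn⇓ : ∀ e n → g ⊢ fn e · n ⇓ eval e g (n ∷ [])
  fn⇓ e n = comp (pair⇓ id⇓ zero) (compile⇓ e (n ∷ []))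

-- Oracle substitution and the use principle

_[_] : Code → Code → Code
zero [ q ]     = zero
succ [ q ]     = succ
fst [ q ]      = fst
snd [ q ]      = snd
oracle [ q ]   = q
pair c d [ q ] = pair (c [ q ]) (d [ q ])
comp c d [ q ] = comp (c [ q ]) (d [ q ])
prec c d [ q ] = prec (c [ q ]) (d [ q ])
mu c [ q ]     = mu (c [ q ])

[]⇓ : ∀ {g h q} → (∀ n → h ⊢ q · n ⇓ g n) → ∀ {c n m} → g ⊢ c · n ⇓ m → h ⊢ c [ q ] · n ⇓ m
[]⇓ hq zero = zero
[]⇓ hq succ = succ
[]⇓ hq fst = fst
[]⇓ hq snd = snd
[]⇓ hq oracle = hq _
[]⇓ hq (pair p r) = pair ([]⇓ hq p) ([]⇓ hq r)
[]⇓ hq (comp p r) = comp ([]⇓ hq p) ([]⇓ hq r)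
[]⇓ hq (prec-zero z p) = prec-zero z ([]⇓ hq p)
[]⇓ hq (prec-suc s p r) = prec-suc s ([]⇓ hq p) ([]⇓ hq r)
[]⇓ hq (mu v p r) = mu v (λ i i<m → []⇓ hq (p i i<m)) ([]⇓ hq r)

-- Merges the witnesses for finitely many indices into one; it serves for uses, halting stages and
-- program numbers alike.
bounded-sup : {P : ℕ → ℕ → Set} → (∀ {i S S′} → S ≤ S′ → P i S → P i S′) →
              ∀ m → (∀ i → i < m → ∃[ S ] P i S) → ∃[ S ] ∀ i → i < m → P i S
bounded-sup mono zero    h = 0 , λ _ ()
bounded-sup {P} mono (suc m) h with bounded-sup {P} mono m (λ i i<m → h i (m<n⇒m<1+n i<m)) | h m ≤-refl
... | S , p | S′ , p′ = S ⊔ S′ , go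
  where
  go : ∀ i → i < suc m → P i (S ⊔ S′)
  go i i<sm with m≤n⇒m<n∨m≡n (s≤s⁻¹ i<sm)
  ... | inj₁ i<m  = mono (m≤m⊔n S S′) (p i i<m)
  ... | inj₂ refl = mono (m≤n⊔m S S′) p′

infix 4 _≈[_]_
_≈[_]_ : Baire → ℕ → Baire → Set
g ≈[ N ] h = ∀ n → n < N → g n ≡ h n

≈-weaken : ∀ {g h M N} → M ≤ N → g ≈[ N ] h → g ≈[ M ] h
≈-weaken M≤N e n n<M = e n (<-≤-trans n<M M≤N)

-- The use principle. An unbounded search contributes the maximum of the uses of its finitely many
-- tests.
use : ∀ {g c n m} → g ⊢ c · n ⇓ m → ∃[ L ] ∀ h → g ≈[ L ] h → h ⊢ c · n ⇓ m
use zero = 0 , λ _ _ → zero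
use succ = 0 , λ _ _ → succ
use fst = 0 , λ _ _ → fst
use snd = 0 , λ _ _ → snd
use {n = n} oracle = suc n , λ h e → ⇓≡ oracle (sym (e n ≤-refl))
use (pair p q) with use p | use q
... | L , u | L′ , u′ = L ⊔ L′ , λ h e → pair (u h (≈-weaken (m≤m⊔n L L′) e)) (u′ h (≈-weaken (m≤n⊔m L L′) e))
use (comp p q) with use p | use q
... | L , u | L′ , u′ = L ⊔ L′ , λ h e → comp (u h (≈-weaken (m≤m⊔n L L′) e)) (u′ h (≈-weaken (m≤n⊔m L L′) e))
use (prec-zero z p) with use p
... | L , u = L , λ h e → prec-zero z (u h e)
use (prec-suc s p q) with use p | use q
... | L , u | L′ , u′ = L ⊔ L′ , λ h e → prec-suc s (u h (≈-weaken (m≤m⊔n L L′) e)) (u′ h (≈-weaken (m≤n⊔m L L′) e))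
use {g} {mu c} {n} {m} (mu v p q)
  with bounded-sup {λ i L → ∀ h → g ≈[ L ] h → h ⊢ c · ⟨ n , i ⟩ ⇓ suc (v i)}
         (λ S≤S′ u h e → u h (≈-weaken S≤S′ e)) m (λ i i<m → use (p i i<m)) | use q
... | L , u | L′ , u′ = L ⊔ L′ , λ h e →
  mu v (λ i i<m → u i i<m h (≈-weaken (m≤m⊔n L L′) e)) (u′ h (≈-weaken (m≤n⊔m L L′) e))

-- Expressions on coded strings

#0 : ∀ {n} → Exp (1 + n)
#0 = var zero
#1 : ∀ {n} → Exp (2 + n)
#1 = var (suc zero)
#2 : ∀ {n} → Exp (3 + n)
#2 = var (suc (suc zero))
#3 : ∀ {n} → Exp (4 + n)
#3 = var (suc (suc (suc zero)))
#4 : ∀ {n} → Exp (5 + n)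
#4 = var (suc (suc (suc (suc zero))))
#5 : ∀ {n} → Exp (6 + n)
#5 = var (suc (suc (suc (suc (suc zero)))))
#6 : ∀ {n} → Exp (7 + n)
#6 = var (suc (suc (suc (suc (suc (suc zero))))))
#7 : ∀ {n} → Exp (8 + n)
#7 = var (suc (suc (suc (suc (suc (suc (suc zero)))))))

encodeString-∷ : ∀ x σ → encodeString (x ∷ σ) ≡ suc (x ⊗ encodeString σ)
encodeString-∷ x σ = cong suc (sym (⊗≡⟨,⟩ x _))

applyUpTo-≈ : ∀ {f g : Baire} n → f ≈[ n ] g → applyUpTo f n ≡ applyUpTo g n
applyUpTo-≈ zero    e = refl
applyUpTo-≈ (suc n) e = cong₂ _∷_ (e 0 z<s) (applyUpTo-≈ n λ i i<n → e (suc i) (s<s i<n))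

-- Allows the code of a string to serve as a loop bound and as a number of steps.
length≤code : ∀ g n → n ≤ encodeString (g ↾ n)
length≤code g zero    = z≤n
length≤code g (suc n) = s≤s (≤-trans (length≤code (λ i → g (suc i)) n) (snd≤pair (g 0) _))

encode↾ : ∀ {f g : Baire} n → f ≗ g → encodeString (f ↾ n) ≡ encodeString (g ↾ n)
encode↾ n e = cong encodeString (applyUpTo-≈ n λ i _ → e i)

-- In b, variable 0 is the position; variables 1 to 3 are internal to the loop.
tab : ∀ {n} → Exp n → Exp (4 + n) → Exp n
tab e b = lt e (rec #0 ze (su (lt (#2 ∸ᵉ su #0) b ⊗ᵉ #1)))

-- The string is built from its end: after k rounds it holds the last k entries, hence the position
-- `N ∸ suc k`.
eval-tab : ∀ {n} (e : Exp n) b g ρ (F : ℕ → ℕ) →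
           (∀ i k r n → eval b g (i ∷ k ∷ r ∷ n ∷ ρ) ≡ F i) →
           eval (tab e b) g ρ ≡ encodeString (F ↾ eval e g ρ)
eval-tab e b g ρ F hF = trans (go (eval e g ρ) ≤-refl) (encode↾ (eval e g ρ) λ i → cong (λ t → F (t + i)) (n∸n≡0 (eval e g ρ)))
  where
  N = eval e g ρ
  go : ∀ k → k ≤ N →
       natrec 0 (λ k r → suc (eval b g (N ∸ suc k ∷ k ∷ r ∷ N ∷ ρ) ⊗ r)) k ≡
       encodeString ((λ i → F (N ∸ k + i)) ↾ k)
  go zero    _   = refl
  go (suc k) k<N = begin
    suc (eval b g (N ∸ suc k ∷ k ∷ _ ∷ N ∷ ρ) ⊗ _)
      ≡⟨ cong suc (cong₂ _⊗_ (hF (N ∸ suc k) k _ N) (go k (<⇒≤ k<N))) ⟩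
    suc (F (N ∸ suc k) ⊗ encodeString ((λ i → F (N ∸ k + i)) ↾ k))
      ≡⟨ sym (encodeString-∷ _ _) ⟩
    encodeString (F (N ∸ suc k) ∷ ((λ i → F (N ∸ k + i)) ↾ k))
      ≡⟨ cong encodeString (cong₂ _∷_ (cong F (sym (+-identityʳ _)))
           (applyUpTo-≈ k λ i _ → cong F (shift i))) ⟩
    encodeString ((λ i → F (N ∸ suc k + i)) ↾ suc k) ∎
    where
    open ≡-Reasoning
    shift : ∀ i → N ∸ k + i ≡ N ∸ suc k + suc i
    shift i = trans (cong (_+ i) (sym (m∸[1+n]≡pred-suc))) (sym (+-suc (N ∸ suc k) i))
      where
      m∸[1+n]≡pred-suc : suc (N ∸ suc k) ≡ N ∸ k
      m∸[1+n]≡pred-suc = sym (+-∸-assoc 1 k<N)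

-- The entry of the string z at position n: 0 beyond its end, otherwise
-- the successor of the entry.
lk : ∀ {n} → Exp n → Exp n → Exp n
lk z n = rec (rec n z (rec #1 ze (sd #0))) ze (su (ft #0))

-- The iterated `natrec 0 (λ k _ → p₂ k)` is the tail of a coded string; the empty string, coded by
-- 0, is its own tail.
dropℕ : ℕ → ℕ → ℕ
dropℕ z = natrec z (λ _ → natrec 0 (λ k _ → p₂ k))

lkℕ : ℕ → ℕ → ℕ
lkℕ z n = natrec 0 (λ k _ → suc (p₁ k)) (dropℕ z n)

tail-↾ : ∀ g n → natrec 0 (λ k _ → p₂ k) (encodeString (g ↾ n)) ≡ encodeString ((λ i → g (suc i)) ↾ pred n)
tail-↾ g zero    = refl
tail-↾ g (suc n) = p₂-⟨,⟩ (g 0) _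

dropℕ-↾ : ∀ g L n → dropℕ (encodeString (g ↾ L)) n ≡ encodeString ((λ i → g (n + i)) ↾ (L ∸ n))
dropℕ-↾ g L zero    = refl
dropℕ-↾ g L (suc n) =
  trans (cong (natrec 0 (λ k _ → p₂ k)) (dropℕ-↾ g L n))
  (trans (tail-↾ (λ i → g (n + i)) (L ∸ n))
  (trans (cong (λ l → encodeString ((λ i → g (n + suc i)) ↾ l)) (pred[m∸n]≡m∸[1+n] L n))
         (encode↾ (L ∸ suc n) λ i → cong g (+-suc n i))))

head-↾ : ∀ g n → 0 < n → natrec 0 (λ k _ → suc (p₁ k)) (encodeString (g ↾ n)) ≡ suc (g 0)
head-↾ g (suc n) _ = cong suc (p₁-⟨,⟩ (g 0) _)

lkℕ-< : ∀ g {L n} → n < L → lkℕ (encodeString (g ↾ L)) n ≡ suc (g n)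
lkℕ-< g {L} {n} n<L =
  trans (cong (natrec 0 (λ k _ → suc (p₁ k))) (dropℕ-↾ g L n))
  (trans (head-↾ (λ i → g (n + i)) (L ∸ n) (m<n⇒0<n∸m n<L)) (cong (λ i → suc (g i)) (+-identityʳ n)))

lkℕ-≥ : ∀ g {L n} → L ≤ n → lkℕ (encodeString (g ↾ L)) n ≡ 0
lkℕ-≥ g {L} {n} L≤n =
  trans (cong (natrec 0 (λ k _ → suc (p₁ k))) (dropℕ-↾ g L n))
        (cong (λ l → natrec 0 (λ k _ → suc (p₁ k)) (encodeString ((λ i → g (n + i)) ↾ l))) (m≤n⇒m∸n≡0 L≤n))

-- A universal program

lit : ∀ {n} → ℕ → Exp n
lit zero    = ze
lit (suc k) = su (lit k)

-- A stack machine evaluating programs.  A state is either ev d n K (run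
-- program d on input n, then continue with stack K) or rt v K (return v
-- to stack K).  A frame is tag ⊗ data, with tag 0 for a pair whose second
-- component is pending, 1 for a pair whose first component is known, 2 for
-- the outer program of a composition, 3 for the step of a primitive
-- recursion and 4 for an unbounded search.
ev : ℕ → ℕ → ℕ → ℕ
ev d n K = 0 ⊗ (d ⊗ n) ⊗ K

rt : ℕ → ℕ → ℕ
rt v K = 1 ⊗ v ⊗ K

infixr 5 _∷ᶠ_
_∷ᶠ_ : ℕ → ℕ → ℕ
f ∷ᶠ K = suc (f ⊗ K)

evᵉ : ∀ {n} → Exp n → Exp n → Exp n → Exp n
evᵉ d n K = ze ⊗ᵉ (d ⊗ᵉ n) ⊗ᵉ K

rtᵉ : ∀ {n} → Exp n → Exp n → Exp n
rtᵉ v K = lit 1 ⊗ᵉ v ⊗ᵉ K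

pushᵉ : ∀ {n} → Exp n → Exp n → Exp n
pushᵉ f K = su (f ⊗ᵉ K)

switch : ∀ {n} → Exp n → List (Exp n) → Exp n → Exp n
switch t []       e = e
switch t (a ∷ as) e = ifz t a (switch (t ∸ᵉ lit 1) as e)

-- Variables: oracle answer, program tag, program arguments, input, stack, program.
evStep : ∀ {n} → Exp (6 + n)
evStep = switch #1
  ( rtᵉ ze #4
  ∷ rtᵉ (su #3) #4
  ∷ rtᵉ (ft #3) #4
  ∷ rtᵉ (sd #3) #4
  ∷ rtᵉ #0 #4
  ∷ evᵉ (ft #2) #3 (pushᵉ (ze ⊗ᵉ sd #2 ⊗ᵉ #3) #4)
  ∷ evᵉ (sd #2) #3 (pushᵉ (lit 2 ⊗ᵉ ft #2) #4)
  ∷ ifz (sd #3)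
      (evᵉ (ft #2) (ft #3) #4)
      (evᵉ #5 (ft #3 ⊗ᵉ (sd #3 ∸ᵉ lit 1)) (pushᵉ (lit 3 ⊗ᵉ sd #2 ⊗ᵉ ft #3 ⊗ᵉ (sd #3 ∸ᵉ lit 1)) #4))
  ∷ [])
  (evᵉ #2 (#3 ⊗ᵉ ze) (pushᵉ (lit 4 ⊗ᵉ #2 ⊗ᵉ #3 ⊗ᵉ ze) #4))

-- Variables: frame tag, frame data, returned value, stack.
rtStep : ∀ {n} → Exp (4 + n)
rtStep = switch #0
  ( evᵉ (ft #1) (sd #1) (pushᵉ (lit 1 ⊗ᵉ #2) #3)
  ∷ rtᵉ (#1 ⊗ᵉ #2) #3
  ∷ evᵉ #1 #2 #3
  ∷ evᵉ (ft #1) (ft (sd #1) ⊗ᵉ sd (sd #1) ⊗ᵉ #2) #3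
  ∷ [])
  (ifz #2
    (rtᵉ (sd (sd #1)) #3)
    (evᵉ (ft #1) (ft (sd #1) ⊗ᵉ su (sd (sd #1)))
         (pushᵉ (lit 4 ⊗ᵉ ft #1 ⊗ᵉ ft (sd #1) ⊗ᵉ su (sd (sd #1))) #3)))

evStepℕ : ℕ → ℕ → ℕ → ℕ → ℕ → ℕ → ℕ
evStepℕ w t p n K d = eval evStep (λ _ → 0) (w ∷ t ∷ p ∷ n ∷ K ∷ d ∷ [])

rtStepℕ : ℕ → ℕ → ℕ → ℕ → ℕ
rtStepℕ t a v K = eval rtStep (λ _ → 0) (t ∷ a ∷ v ∷ K ∷ [])

-- Zero iff the state q queries the oracle at a position beyond the end of z;
-- the machine then waits.
answer : ∀ {n} → Exp n → Exp n → Exp n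
answer z q =
  ifz (ft q)
    -- With 0 as truth, both truncated differences hold exactly for tag 4, the tag of `oracle`.
    (ifz ((tag ∸ᵉ lit 4) ∧₀ (lit 4 ∸ᵉ tag)) (lk z (sd (ft (sd q)))) (lit 1))
    (lit 1)
  where
  tag = ft (ft (ft (sd q)))
  _∧₀_ : ∀ {n} → Exp n → Exp n → Exp n
  a ∧₀ b = ifz a b (lit 1)

answerℕ : ℕ → ℕ → ℕ
answerℕ z q = eval (answer #0 #1) (λ _ → 0) (z ∷ q ∷ [])

-- Variables: oracle answer plus one, state.
move : ∀ {n} → Exp (2 + n)
move =
  ifz #0 #1
    (ifz (ft #1)
      (lt (ft (ft (sd #1)))
        (lt (sd (sd #2)) (lt (sd (ft (sd #3))) (lt (sd #2) (lt (ft #3) (lt (#5 ∸ᵉ lit 1) evStep))))))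
      (ifz (sd (sd #1)) #1
        (lt (sd (sd (sd #1) ∸ᵉ lit 1))
          (lt (ft (sd #2)) (lt (sd (ft (sd (sd #3) ∸ᵉ lit 1))) (lt (ft (ft (sd (sd #4) ∸ᵉ lit 1))) rtStep))))))

moveℕ : ℕ → ℕ → ℕ
moveℕ a q = eval move (λ _ → 0) (a ∷ q ∷ [])

move-ev : ∀ w d n K → moveℕ (suc w) (ev d n K) ≡ evStepℕ w (p₁ d) (p₂ d) n K d
move-ev w d n K
  rewrite p₁-⊗ 0 ((d ⊗ n) ⊗ K) | p₂-⊗ 0 ((d ⊗ n) ⊗ K) | p₁-⊗ (d ⊗ n) K | p₂-⊗ (d ⊗ n) K
        | p₁-⊗ d n | p₂-⊗ d n = refl

move-rt : ∀ w v f K → moveℕ (suc w) (rt v (f ∷ᶠ K)) ≡ rtStepℕ (p₁ f) (p₂ f) v K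
move-rt w v f K
  rewrite p₁-⊗ 1 (v ⊗ (f ∷ᶠ K)) | p₂-⊗ 1 (v ⊗ (f ∷ᶠ K)) | p₁-⊗ v (f ∷ᶠ K) | p₂-⊗ v (f ∷ᶠ K)
        | p₁-⊗ f K | p₂-⊗ f K = refl

answer-rt : ∀ z v K → answerℕ z (rt v K) ≡ 1
answer-rt z v K rewrite p₁-⊗ 1 (v ⊗ K) = refl

answer-ev : ∀ z d n K {t} → p₁ d ≡ t → t ≢ 4 → answerℕ z (ev d n K) ≡ 1
answer-ev z d n K {t} eq t≢4
  rewrite p₁-⊗ 0 ((d ⊗ n) ⊗ K) | p₂-⊗ 0 ((d ⊗ n) ⊗ K) | p₁-⊗ (d ⊗ n) K
        | p₁-⊗ d n | p₂-⊗ d n | eq = go t t≢4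
  where
  go : ∀ t → t ≢ 4 →
       natrec (natrec (lkℕ z n) (λ _ _ → 1) (natrec (4 ∸ t) (λ _ _ → 1) (t ∸ 4))) (λ _ _ → 1) 0 ≡ 1
  go 0 _ = refl
  go 1 _ = refl
  go 2 _ = refl
  go 3 _ = refl
  go 4 4≢4 = contradiction refl 4≢4
  go (suc (suc (suc (suc (suc t))))) _ = refl

answer-oracle : ∀ z d n K → p₁ d ≡ 4 → answerℕ z (ev d n K) ≡ lkℕ z n
answer-oracle z d n K eq
  rewrite p₁-⊗ 0 ((d ⊗ n) ⊗ K) | p₂-⊗ 0 ((d ⊗ n) ⊗ K) | p₁-⊗ (d ⊗ n) K
        | p₁-⊗ d n | p₂-⊗ d n | eq = refl

opaque
  step : ℕ → ℕ → ℕ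
  step z q = moveℕ (answerℕ z q) q

  step-ev : ∀ z d n K {t} → p₁ d ≡ t → t ≢ 4 → step z (ev d n K) ≡ evStepℕ 0 t (p₂ d) n K d
  step-ev z d n K {t} eq t≢4 = begin
    moveℕ (answerℕ z (ev d n K)) (ev d n K) ≡⟨ cong (λ a → moveℕ a (ev d n K)) (answer-ev z d n K eq t≢4) ⟩
    moveℕ 1 (ev d n K)                      ≡⟨ move-ev 0 d n K ⟩
    evStepℕ 0 (p₁ d) (p₂ d) n K d           ≡⟨ cong (λ t → evStepℕ 0 t (p₂ d) n K d) eq ⟩
    evStepℕ 0 t (p₂ d) n K d                ∎
    where open ≡-Reasoning

  step-oracle : ∀ z d n K {w} → p₁ d ≡ 4 → lkℕ z n ≡ suc w → step z (ev d n K) ≡ rt w K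
  step-oracle z d n K {w} eq l = begin
    moveℕ (answerℕ z (ev d n K)) (ev d n K)
      ≡⟨ cong (λ a → moveℕ a (ev d n K)) (trans (answer-oracle z d n K eq) l) ⟩
    moveℕ (suc w) (ev d n K)      ≡⟨ move-ev w d n K ⟩
    evStepℕ w (p₁ d) (p₂ d) n K d ≡⟨ cong (λ t → evStepℕ w t (p₂ d) n K d) eq ⟩
    rt w K                        ∎
    where open ≡-Reasoning

  step-rt : ∀ z v t a K → step z (rt v (t ⊗ a ∷ᶠ K)) ≡ rtStepℕ t a v K
  step-rt z v t a K = begin
    moveℕ (answerℕ z (rt v (t ⊗ a ∷ᶠ K))) (rt v (t ⊗ a ∷ᶠ K))
      ≡⟨ cong (λ b → moveℕ b (rt v (t ⊗ a ∷ᶠ K))) (answer-rt z v _) ⟩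
    moveℕ 1 (rt v (t ⊗ a ∷ᶠ K)) ≡⟨ move-rt 0 v (t ⊗ a) K ⟩
    rtStepℕ (p₁ (t ⊗ a)) (p₂ (t ⊗ a)) v K ≡⟨ cong₂ (λ t a → rtStepℕ t a v K) (p₁-⊗ t a) (p₂-⊗ t a) ⟩
    rtStepℕ t a v K ∎
    where open ≡-Reasoning

run : ℕ → ℕ → ℕ → ℕ
run z s q = natrec q (λ _ → step z) s

run-+ : ∀ z s s′ q → run z (s′ + s) q ≡ run z s′ (run z s q)
run-+ z s zero     q = refl
run-+ z s (suc s′) q = cong (step z) (run-+ z s s′ q)

outᵉ : ∀ {n} → Exp n → Exp n
outᵉ q = ifz (ft q) ze (ifz (sd (sd q)) (su (ft (sd q))) ze)

opaque
  out : ℕ → ℕ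
  out q = eval (outᵉ #0) (λ _ → 0) (q ∷ [])

  out-rt : ∀ v → out (rt v 0) ≡ suc v
  out-rt v rewrite p₁-⊗ 1 (v ⊗ 0) | p₂-⊗ 1 (v ⊗ 0) | p₁-⊗ v 0 | p₂-⊗ v 0 = refl

opaque
  unfolding step out

  halted-fixed : ∀ z q {m} → out q ≡ suc m → step z q ≡ q
  halted-fixed z q eq with answerℕ z q
  ... | zero = refl
  ... | suc w with p₁ q | p₂ (p₂ q)
  ...   | suc _ | zero  = refl

infix 4 _⊑_
_⊑_ : ℕ → ℕ → Set
z ⊑ z′ = ∀ n {w} → lkℕ z n ≡ suc w → lkℕ z′ n ≡ suc w

↾-⊑ : ∀ g {L L′} → L ≤ L′ → encodeString (g ↾ L) ⊑ encodeString (g ↾ L′)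
↾-⊑ g {L} {L′} L≤L′ n eq with n <? L
... | yes n<L = trans (lkℕ-< g (<-≤-trans n<L L≤L′)) (trans (sym (lkℕ-< g n<L)) eq)
... | no  n≮L = contradiction (trans (sym eq) (lkℕ-≥ g (≮⇒≥ n≮L))) λ ()

opaque
  unfolding step

  -- The string enters a step only through `answer`, and a missing answer makes the machine wait. So
  -- a longer string alters a step only where the shorter one leaves the state fixed.
  step-mono : ∀ {z z′} → z ⊑ z′ → ∀ q → step z q ≡ q ⊎ step z q ≡ step z′ q
  step-mono {z} {z′} z⊑z′ q
    with go (p₁ q) (natrec (4 ∸ p₁ (p₁ (p₁ (p₂ q)))) (λ _ _ → 1) (p₁ (p₁ (p₁ (p₂ q))) ∸ 4)) (z⊑z′ (p₂ (p₁ (p₂ q))))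
    where
    go : ∀ m x {a a′} → (∀ {w} → a ≡ suc w → a′ ≡ suc w) →
         let f = λ b → natrec (natrec b (λ _ _ → 1) x) (λ _ _ → 1) m in f a ≡ 0 ⊎ f a ≡ f a′
    go (suc m) x       h = inj₂ refl
    go zero    (suc x) h = inj₂ refl
    go zero    zero {zero}  h = inj₁ refl
    go zero    zero {suc w} h = inj₂ (sym (h refl))
  ... | inj₁ eq = inj₁ (cong (λ a → moveℕ a q) eq)
  ... | inj₂ eq = inj₂ (cong (λ a → moveℕ a q) eq)

run-shift : ∀ z s q → run z (suc s) q ≡ run z s (step z q)
run-shift z zero    q = refl
run-shift z (suc s) q = cong (step z) (run-shift z s q)

run-fixed : ∀ z s {q} → step z q ≡ q → run z s q ≡ q
run-fixed z zero    eq = refl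
run-fixed z (suc s) eq = trans (cong (step z) (run-fixed z s eq)) eq

-- If the first step leaves the state fixed, that state has already halted, since the run ends in
-- it; otherwise both strings make the same first step.
halted-mono : ∀ {z z′} → z ⊑ z′ → ∀ s s′ q {m} → out (run z s q) ≡ suc m → out (run z′ (s′ + s) q) ≡ suc m
halted-mono {z} {z′} z⊑z′ zero s′ q eq =
  trans (cong out (run-fixed z′ (s′ + 0) (halted-fixed z′ q eq))) eq
halted-mono {z} {z′} z⊑z′ (suc s) s′ q {m} eq with step-mono z⊑z′ q
... | inj₁ fixed =
  trans (cong out (run-fixed z′ (s′ + suc s) (halted-fixed z′ q out-q))) out-q
  where
  out-q : out q ≡ suc m
  out-q = trans (cong out (sym (run-fixed z (suc s) fixed))) eq
... | inj₂ same = begin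
  out (run z′ (s′ + suc s) q)       ≡⟨ cong (λ k → out (run z′ k q)) (+-suc s′ s) ⟩
  out (run z′ (suc (s′ + s)) q)     ≡⟨ cong out (run-shift z′ (s′ + s) q) ⟩
  out (run z′ (s′ + s) (step z′ q)) ≡⟨ cong (λ r → out (run z′ (s′ + s) r)) (sym same) ⟩
  out (run z′ (s′ + s) (step z q))
    ≡⟨ halted-mono z⊑z′ s s′ (step z q) (trans (cong out (sym (run-shift z s q))) eq) ⟩
  suc m ∎
  where open ≡-Reasoning

infix 4 _⊢_⟶_
_⊢_⟶_ : Baire → ℕ → ℕ → Set
g ⊢ q ⟶ q′ = ∃[ s ] ∃[ L ] ∀ L′ → L ≤ L′ → run (encodeString (g ↾ L′)) s q ≡ q′

module _ {g : Baire} where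

  ⟶-step : ∀ {q q′} → (∀ z → step z q ≡ q′) → g ⊢ q ⟶ q′
  ⟶-step h = 1 , 0 , λ L′ _ → h _

  infixr 4 _⟫_
  _⟫_ : ∀ {q q′ q″} → g ⊢ q ⟶ q′ → g ⊢ q′ ⟶ q″ → g ⊢ q ⟶ q″
  (s , L , r) ⟫ (s′ , L′ , r′) = s′ + s , L ⊔ L′ , λ M le →
    trans (run-+ _ s s′ _)
      (trans (cong (run _ s′) (r M (m⊔n≤o⇒m≤o L L′ le))) (r′ M (m⊔n≤o⇒n≤o L L′ le)))

  via : ∀ {q q₁ q′} → (∀ z → step z q ≡ q₁) → g ⊢ q₁ ⟶ q′ → g ⊢ q ⟶ q′
  via h r = ⟶-step h ⟫ r

  to : ∀ {q a b} → a ≡ b → g ⊢ q ⟶ a → g ⊢ q ⟶ b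
  to refl r = r

  sub : ∀ {c e e′} → e ≡ e′ → c ≡ decode e′ → c ≡ decodeNode decode (p₁ e , p₂ e)
  sub refl eq = trans eq (decode-unfold _)

  simulate : ∀ {c n m} → g ⊢ c · n ⇓ m → ∀ d → c ≡ decodeNode decode (p₁ d , p₂ d) →
             ∀ K → g ⊢ ev d n K ⟶ rt m K

  -- With the tag as a variable one can match on it; `decodeNode` then reduces and its equation
  -- fixes the shape of the program. The recursion is on the derivation.
  node : ∀ t {d c n m} → p₁ d ≡ t → c ≡ decodeNode decode (t , p₂ d) → g ⊢ c · n ⇓ m →
         ∀ K → g ⊢ ev d n K ⟶ rt m K

  simulate der d eq K = node (p₁ d) refl eq der K

  node 0 {d} tag refl zero K = ⟶-step λ z → step-ev z d _ K tag (λ ())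
  node 1 {d} tag refl succ K = ⟶-step λ z → step-ev z d _ K tag (λ ())
  node 2 {d} tag refl (fst {n}) K =
    to (cong (λ v → rt v K) (p₁≡π₁ n)) (⟶-step λ z → step-ev z d n K tag (λ ()))
  node 3 {d} tag refl (snd {n}) K =
    to (cong (λ v → rt v K) (p₂≡π₂ n)) (⟶-step λ z → step-ev z d n K tag (λ ()))
  node 4 {d} tag refl (oracle {n}) K = 1 , suc n , λ L′ n<L′ → step-oracle _ d n K tag (lkℕ-< g n<L′)
  node 5 {d} tag refl (pair {n = n} {a} {b} der der′) K =
    via (λ z → step-ev z d n K tag (λ ()))
      (simulate der _ (sub (p₁≡π₁ _) refl) _
    ⟫ via (λ z → trans (step-rt z a 0 _ K) (cong₂ (λ x y → ev x y (1 ⊗ a ∷ᶠ K)) (p₁-⊗ _ _) (p₂-⊗ _ _)))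
      (simulate der′ _ (sub (p₂≡π₂ _) refl) _
    ⟫ to (cong (λ v → rt v K) (⊗≡⟨,⟩ a b)) (⟶-step λ z → step-rt z b 1 a K)))
  node 6 {d} tag refl (comp {n = n} {k} der der′) K =
    via (λ z → step-ev z d n K tag (λ ()))
      (simulate der _ (sub (p₂≡π₂ _) refl) _
    ⟫ via (λ z → step-rt z k 2 _ K)
      (simulate der′ _ (sub (p₁≡π₁ _) refl) K))
  node 7 {d} tag refl (prec-zero {n = n} z≡ der) K =
    via (λ z → trans (step-ev z d n K tag (λ ()))
                     (trans (cong (λ k → natrec (ev (p₁ (p₂ d)) (p₁ n) K) (λ _ _ → ev d (p₁ n ⊗ (p₂ n ∸ 1)) (3 ⊗ p₂ (p₂ d) ⊗ p₁ n ⊗ (p₂ n ∸ 1) ∷ᶠ K)) k)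
                              (trans (p₂≡π₂ n) z≡))
                            (cong (λ x → ev (p₁ (p₂ d)) x K) (p₁≡π₁ n))))
      (simulate der _ (sub (p₁≡π₁ _) refl) K)
  node 7 {d} tag refl (prec-suc {n = n} {k} {r} s≡ der der′) K =
    via (λ z → trans (step-ev z d n K tag (λ ()))
                     (cong (λ k → natrec (ev (p₁ (p₂ d)) (p₁ n) K) (λ _ _ → ev d (p₁ n ⊗ (k ∸ 1)) (3 ⊗ p₂ (p₂ d) ⊗ p₁ n ⊗ (k ∸ 1) ∷ᶠ K)) k)
                           (trans (p₂≡π₂ n) s≡)))
      (subst (λ i → g ⊢ ev d i F ⟶ rt r F) (sym input)
         (simulate der d (cong (λ t → decodeNode decode (t , p₂ d)) (sym tag)) F)
    ⟫ via (λ z → trans (step-rt z r 3 _ K) (cong₂ (λ x y → ev x y K) (p₁-⊗ _ _) next))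
      (simulate der′ _ (sub (p₂≡π₂ _) refl) K))
    where
    F = 3 ⊗ p₂ (p₂ d) ⊗ p₁ n ⊗ k ∷ᶠ K
    input : p₁ n ⊗ k ≡ ⟨ π₁ n , k ⟩
    input = trans (⊗≡⟨,⟩ _ k) (cong (λ x → ⟨ x , k ⟩) (p₁≡π₁ n))
    a = p₂ (p₂ d) ⊗ p₁ n ⊗ k
    p₂a : p₂ a ≡ p₁ n ⊗ k
    p₂a = p₂-⊗ _ _
    next : p₁ (p₂ a) ⊗ p₂ (p₂ a) ⊗ r ≡ ⟨ π₁ n , ⟨ k , r ⟩ ⟩
    next = begin
      p₁ (p₂ a) ⊗ p₂ (p₂ a) ⊗ r           ≡⟨ cong (λ b → p₁ b ⊗ p₂ b ⊗ r) p₂a ⟩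
      p₁ (p₁ n ⊗ k) ⊗ p₂ (p₁ n ⊗ k) ⊗ r   ≡⟨ cong₂ (λ x y → x ⊗ y ⊗ r) (p₁-⊗ _ _) (p₂-⊗ _ _) ⟩
      p₁ n ⊗ k ⊗ r                        ≡⟨ ⊗≡⟨,⟩ (p₁ n) _ ⟩
      ⟨ p₁ n , k ⊗ r ⟩                    ≡⟨ cong₂ ⟨_,_⟩ (p₁≡π₁ n) (⊗≡⟨,⟩ k r) ⟩
      ⟨ π₁ n , ⟨ k , r ⟩ ⟩                ∎
      where open ≡-Reasoning
  -- Every tag from 8 on decodes to `mu`, in agreement with the default branch of `evStep`.
  node (suc (suc (suc (suc (suc (suc (suc (suc t)))))))) {d} tag refl (mu {n = n} {m} v ders der) K =
    via (λ z → step-ev z d n K tag (λ ())) (loop m 0 refl)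
    where
    p = p₂ d
    a : ℕ → ℕ
    a i = p ⊗ n ⊗ i
    F : ℕ → ℕ
    F i = 4 ⊗ a i ∷ᶠ K
    p₂a : ∀ i → p₂ (a i) ≡ n ⊗ i
    p₂a i = p₂-⊗ _ _
    p₁p₂a : ∀ i → p₁ (p₂ (a i)) ≡ n
    p₁p₂a i = trans (cong p₁ (p₂a i)) (p₁-⊗ n i)
    p₂p₂a : ∀ i → p₂ (p₂ (a i)) ≡ i
    p₂p₂a i = trans (cong p₂ (p₂a i)) (p₂-⊗ n i)
    found : ∀ z i → step z (rt 0 (F i)) ≡ rt i K
    found z i = trans (step-rt z 0 4 (a i) K) (cong (λ j → rt j K) (p₂p₂a i))
    again : ∀ z w i → step z (rt (suc w) (F i)) ≡ ev p (n ⊗ suc i) (F (suc i))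
    again z w i = trans (step-rt z (suc w) 4 (a i) K)
      (trans (cong₂ (λ x y → ev x (y ⊗ suc (p₂ (p₂ (a i)))) (4 ⊗ x ⊗ y ⊗ suc (p₂ (p₂ (a i))) ∷ᶠ K))
                    (p₁-⊗ p _) (p₁p₂a i))
             (cong (λ j → ev p (n ⊗ suc j) (4 ⊗ p ⊗ n ⊗ suc j ∷ᶠ K)) (p₂p₂a i)))
    loop : ∀ j i → i + j ≡ m → g ⊢ ev p (n ⊗ i) (F i) ⟶ rt m K
    loop zero i eq =
      subst (λ x → g ⊢ ev p x (F i) ⟶ rt 0 (F i)) (trans (cong (λ i → ⟨ n , i ⟩) (sym i≡m)) (sym (⊗≡⟨,⟩ n i)))
        (simulate der p (decode-unfold p) (F i))
      ⟫ to (cong (λ i → rt i K) i≡m) (⟶-step λ z → found z i)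
      where i≡m = trans (sym (+-identityʳ i)) eq
    loop (suc j) i eq =
      subst (λ x → g ⊢ ev p x (F i) ⟶ rt (suc (v i)) (F i)) (sym (⊗≡⟨,⟩ n i))
        (simulate (ders i (m+1+n≤⇒m< i j eq)) p (decode-unfold p) (F i))
      ⟫ via (λ z → again z (v i) i) (loop j (suc i) (trans (sym (+-suc i j)) eq))
      where
      m+1+n≤⇒m< : ∀ i j → i + suc j ≡ m → i < m
      m+1+n≤⇒m< i j refl = m<m+n i z<s

-- One plus the value if it is found within s steps, 0 otherwise.
Evalℕ : ℕ → ℕ → ℕ → ℕ → ℕ
Evalℕ z s d n = out (run z s (ev d n 0))

-- Variables: z, s, d, n.
Evalᵉ : ∀ {n} → Exp (4 + n)
Evalᵉ = lt (rec #1 (evᵉ #2 #3 ze) (lt #1 (lt (answer #3 #0) move))) (outᵉ #0)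

opaque
  unfolding step out

  Eval-Evalᵉ : ∀ {k} g z s d n (ρ : Vec ℕ k) → eval Evalᵉ g (z ∷ s ∷ d ∷ n ∷ ρ) ≡ Evalℕ z s d n
  Eval-Evalᵉ g z s d n ρ = refl

Eval-complete : ∀ {g d n m} → g ⊢ decode d · n ⇓ m →
                ∃[ S ] ∀ s L → S ≤ s → S ≤ L → Evalℕ (encodeString (g ↾ L)) s d n ≡ suc m
Eval-complete {g} {d} {n} {m} der with simulate der d (decode-unfold d) 0
... | S , L₀ , reach = S ⊔ L₀ , λ s L S≤s S≤L →
  subst (λ s → Evalℕ (encodeString (g ↾ L)) s d n ≡ suc m) (m∸n+n≡m (m⊔n≤o⇒m≤o S L₀ S≤s))
    (halted-mono (λ _ e → e) S (s ∸ S) (ev d n 0)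
      (trans (cong out (reach L (m⊔n≤o⇒n≤o S L₀ S≤L))) (out-rt m)))

-- The machine need not be inverted: a value once found persists until the stage at which
-- `Eval-complete` yields the true one. Hence the restriction to inputs on which the program halts.
Eval-sound : ∀ {g d n m} → g ⊢ decode d · n ⇓ m → ∀ L s {m′} →
             Evalℕ (encodeString (g ↾ L)) s d n ≡ suc m′ → m′ ≡ m
Eval-sound {g} {d} {n} {m} der L s {m′} eq with Eval-complete der
... | S , complete = suc-injective (trans (sym later) (complete (S + s) (S ⊔ L) (m≤m+n S s) (m≤m⊔n S L)))
  where
  later : Evalℕ (encodeString (g ↾ (S ⊔ L))) (S + s) d n ≡ suc m′
  later = halted-mono (↾-⊑ g (m≤n⊔m S L)) s S (ev d n 0) eq

-- The search of an oracle computation: the input is ((d , n) , s).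
evalAt : Exp 1
evalAt = lt (sd (ft #0)) (lt (ft (ft #1)) (lt (sd #2) (lt (tab #0 (orc #0)) Evalᵉ)))

eval-evalAt : ∀ g d n s → eval evalAt g ((d ⊗ n) ⊗ s ∷ []) ≡ Evalℕ (encodeString (g ↾ s)) s d n
eval-evalAt g d n s rewrite p₂-⊗ (d ⊗ n) s | p₁-⊗ (d ⊗ n) s | p₁-⊗ d n | p₂-⊗ d n =
  trans (Eval-Evalᵉ g (eval (tab #0 (orc #0)) g ρ) s d n ((d ⊗ n) ⊗ s ∷ []))
        (cong (λ z → Evalℕ z s d n) (eval-tab #0 (orc #0) g ρ g (λ i k r n → refl)))
  where ρ = s ∷ d ∷ n ∷ (d ⊗ n) ⊗ s ∷ []

mu⇓ : ∀ {g c n} (F : ℕ → ℕ) → (∀ i → g ⊢ c · n ⊗ i ⇓ F i) →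
      ∀ S → F S ≡ 0 → ∃[ m ] F m ≡ 0 × g ⊢ mu c · n ⇓ m
mu⇓ {g} {c} {n} F hF S FS = search S 0 (λ _ ()) (trans (cong F (+-identityʳ S)) FS)
  where
  hF′ : ∀ i {v} → F i ≡ v → g ⊢ c · ⟨ n , i ⟩ ⇓ v
  hF′ i refl = subst (λ x → g ⊢ c · x ⇓ F i) (⊗≡⟨,⟩ n i) (hF i)
  positive : ∀ x → x ≢ 0 → x ≡ suc (pred x)
  positive zero    h = contradiction refl h
  positive (suc x) h = refl
  search : ∀ k i → (∀ j → j < i → F j ≢ 0) → F (k + i) ≡ 0 → ∃[ m ] F m ≡ 0 × g ⊢ mu c · n ⇓ m
  search k i below zeroAt with F i ≟ 0
  ... | yes Fi≡0 = i , Fi≡0 , mu (λ j → pred (F j)) (λ j j<i → hF′ j (positive (F j) (below j j<i))) (hF′ i Fi≡0)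
  search zero    i below zeroAt | no Fi≢0 = contradiction zeroAt Fi≢0
  search (suc k) i below zeroAt | no Fi≢0 = search k (suc i) below′ (trans (cong F (+-suc k i)) zeroAt)
    where
    below′ : ∀ j → j < suc i → F j ≢ 0
    below′ j j<si with m≤n⇒m<n∨m≡n (s≤s⁻¹ j<si)
    ... | inj₁ j<i  = below j j<i
    ... | inj₂ refl = Fi≢0

opaque
  universal : Code
  universal = comp (fn (evalAt ∸ᵉ lit 1)) (pair idc (mu (fn (ifz evalAt (lit 1) ze))))

  universal⇓ : ∀ {g d n m} → g ⊢ decode d · n ⇓ m → g ⊢ universal · d ⊗ n ⇓ m
  universal⇓ {g} {d} {n} {m} der with Eval-complete der
  ... | S , complete with mu⇓ {n = d ⊗ n} (λ s → natrec 1 (λ _ _ → 0) (eval evalAt g ((d ⊗ n) ⊗ s ∷ [])))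
                          (λ s → fn⇓ (ifz evalAt (lit 1) ze) _) S
                          (cong (natrec 1 (λ _ _ → 0)) (trans (eval-evalAt g d n S) (complete S S ≤-refl ≤-refl)))
  ... | s , found , der-mu =
    comp (pair⇓ id⇓ der-mu) (⇓≡ (fn⇓ (evalAt ∸ᵉ lit 1) _)
      (trans (cong (_∸ 1) (eval-evalAt g d n s)) (value _ refl)))
    where
    value : ∀ v → Evalℕ (encodeString (g ↾ s)) s d n ≡ v → v ∸ 1 ≡ m
    value zero eq with () ← trans (sym found) (cong (natrec 1 (λ _ _ → 0)) (trans (eval-evalAt g d n s) eq))
    value (suc m′) eq = Eval-sound der s s eq

-- Computable program transformations (s-m-n)

const : ℕ → Code
const zero    = zero
const (suc a) = comp succ (const a)

const⇓ : ∀ {g n} a → g ⊢ const a · n ⇓ a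
const⇓ zero    = zero
const⇓ (suc a) = comp (const⇓ a) succ

spec : Code → ℕ → Code
spec u a = comp u (pair (const a) idc)

spec⇓ : ∀ {g u a n m} → g ⊢ u · a ⊗ n ⇓ m → g ⊢ spec u a · n ⇓ m
spec⇓ {a = a} p = comp (pair⇓ (const⇓ a) id⇓) p

opaque
  index : Code → ℕ
  index = encode

  decode-index : ∀ c → decode (index c) ≡ c
  decode-index = decode-encode

index⇓ : ∀ {g n m} c → g ⊢ c · n ⇓ m → g ⊢ decode (index c) · n ⇓ m
index⇓ {g} {n} {m} c = subst (λ c → g ⊢ c · n ⇓ m) (sym (decode-index c))

-- Computes the number of `c [ q ]` from the number of `q`, for fixed `c`, so that a learner can
-- output transformed programs.
substᵉ : ∀ {n} → Code → Exp n → Exp n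
substᵉ zero       e = lit 0 ⊗ᵉ lit 0
substᵉ succ       e = lit 1 ⊗ᵉ lit 0
substᵉ fst        e = lit 2 ⊗ᵉ lit 0
substᵉ snd        e = lit 3 ⊗ᵉ lit 0
substᵉ oracle     e = e
substᵉ (pair c d) e = lit 5 ⊗ᵉ substᵉ c e ⊗ᵉ substᵉ d e
substᵉ (comp c d) e = lit 6 ⊗ᵉ substᵉ c e ⊗ᵉ substᵉ d e
substᵉ (prec c d) e = lit 7 ⊗ᵉ substᵉ c e ⊗ᵉ substᵉ d e
substᵉ (mu c)     e = lit 8 ⊗ᵉ substᵉ c e

indexᵉ : ∀ {n} → Code → Exp n
indexᵉ c = substᵉ c (lit 4 ⊗ᵉ lit 0)

specᵉ : ∀ {n} → Exp n → Exp n → Exp n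
specᵉ u a = lit 6 ⊗ᵉ u ⊗ᵉ lit 5 ⊗ᵉ rec a (indexᵉ zero) (lit 6 ⊗ᵉ indexᵉ succ ⊗ᵉ #1) ⊗ᵉ indexᵉ idc

eval-lit : ∀ {n} k g (ρ : Vec ℕ n) → eval (lit k) g ρ ≡ k
eval-lit zero    g ρ = refl
eval-lit (suc k) g ρ = cong suc (eval-lit k g ρ)

[oracle] : ∀ c → c [ oracle ] ≡ c
[oracle] zero = refl
[oracle] succ = refl
[oracle] fst = refl
[oracle] snd = refl
[oracle] oracle = refl
[oracle] (pair c d) = cong₂ pair ([oracle] c) ([oracle] d)
[oracle] (comp c d) = cong₂ comp ([oracle] c) ([oracle] d)
[oracle] (prec c d) = cong₂ prec ([oracle] c) ([oracle] d)
[oracle] (mu c) = cong mu ([oracle] c)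

opaque
  unfolding index

  ⊗⟨⟩ : ∀ t {a b c d} → a ≡ c → b ≡ d → t ⊗ a ⊗ b ≡ ⟨ t , ⟨ c , d ⟩ ⟩
  ⊗⟨⟩ t refl refl = trans (⊗≡⟨,⟩ t _) (cong (λ p → ⟨ t , p ⟩) (⊗≡⟨,⟩ _ _))

  eval-substᵉ : ∀ {n} c {e : Exp n} {q} {g} {ρ} → eval e g ρ ≡ index q → eval (substᵉ c e) g ρ ≡ index (c [ q ])
  eval-substᵉ zero       h = ⊗≡⟨,⟩ _ _
  eval-substᵉ succ       h = ⊗≡⟨,⟩ _ _
  eval-substᵉ fst        h = ⊗≡⟨,⟩ _ _
  eval-substᵉ snd        h = ⊗≡⟨,⟩ _ _
  eval-substᵉ oracle     h = h
  eval-substᵉ (pair c d) h = ⊗⟨⟩ 5 (eval-substᵉ c h) (eval-substᵉ d h)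
  eval-substᵉ (comp c d) h = ⊗⟨⟩ 6 (eval-substᵉ c h) (eval-substᵉ d h)
  eval-substᵉ (prec c d) h = ⊗⟨⟩ 7 (eval-substᵉ c h) (eval-substᵉ d h)
  eval-substᵉ (mu c)     h = trans (⊗≡⟨,⟩ 8 _) (cong (λ p → ⟨ 8 , p ⟩) (eval-substᵉ c h))

  eval-indexᵉ : ∀ {n} c {g} {ρ : Vec ℕ n} → eval (indexᵉ c) g ρ ≡ index c
  eval-indexᵉ c = trans (eval-substᵉ c {q = oracle} (⊗≡⟨,⟩ 4 0)) (cong index ([oracle] c))

  eval-specᵉ : ∀ {n} {e a : Exp n} {u} {g} {ρ} → eval e g ρ ≡ index u →
               eval (specᵉ e a) g ρ ≡ index (spec u (eval a g ρ))
  eval-specᵉ {a = a} {g = g} {ρ} h =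
    ⊗⟨⟩ 6 h (⊗⟨⟩ 5 (go (eval a g ρ)) (eval-indexᵉ idc {g} {ρ}))
    where
    go : ∀ k → natrec (eval (indexᵉ zero) g ρ) (λ k r → eval (lit 6 ⊗ᵉ indexᵉ succ ⊗ᵉ #1) g (k ∷ r ∷ ρ)) k ≡ index (const k)
    go zero    = eval-indexᵉ zero {g} {ρ}
    go (suc k) = ⊗⟨⟩ 6 (eval-indexᵉ succ {g} {k ∷ index (const k) ∷ ρ}) (go k)

specIndex : Code → ℕ → ℕ
specIndex u a = index (spec u a)

specIndexᵉ : ∀ {n} → Code → Exp n → Exp n
specIndexᵉ u a = specᵉ (indexᵉ u) a

eval-specIndexᵉ : ∀ {n} u (a : Exp n) g ρ → eval (specIndexᵉ u a) g ρ ≡ specIndex u (eval a g ρ)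
eval-specIndexᵉ u a g ρ = eval-specᵉ {e = indexᵉ u} {a} (eval-indexᵉ u {g} {ρ})

infix 4 _⊩_↦_
_⊩_↦_ : Baire → Code → Baire → Set
x ⊩ c ↦ z = ∀ n → x ⊢ c · n ⇓ z n

pairU : Code
pairU = pair (comp universal (fn (ft (ft #0) ⊗ᵉ sd #0))) (comp universal (fn (sd (ft #0) ⊗ᵉ sd #0)))

pairIndex : ℕ → ℕ → ℕ
pairIndex d e = specIndex pairU (d ⊗ e)

_⊕_ : Baire → Baire → Baire
(f ⊕ g) n = f n ⊗ g n

pairIndex↦ : ∀ {x y z d e} → Φ d at x ↦ y → Φ e at x ↦ z → Φ (pairIndex d e) at x ↦ (y ⊕ z)
pairIndex↦ {x} {y} {z} {d} {e} p q n = index⇓ _ (spec⇓ (pair⇓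
  (comp (⇓≡ (fn⇓ (ft (ft #0) ⊗ᵉ sd #0) a) (cong₂ _⊗_ (trans (cong p₁ (p₁-⊗ _ n)) (p₁-⊗ d e)) (p₂-⊗ _ n))) (universal⇓ (p n)))
  (comp (⇓≡ (fn⇓ (sd (ft #0) ⊗ᵉ sd #0) a) (cong₂ _⊗_ (trans (cong p₂ (p₁-⊗ _ n)) (p₂-⊗ d e)) (p₂-⊗ _ n))) (universal⇓ (q n)))))
  where a = (d ⊗ e) ⊗ n

-- Program e with its oracle queries answered by program d. Substituting into the fixed program
-- `universal` keeps the number computable from d and e without a recursion over e.
compIndex : ℕ → ℕ → ℕ
compIndex d e = index (spec (universal [ spec universal d ]) e)

compIndexᵉ : ∀ {n} → Exp n → Exp n → Exp n
compIndexᵉ d e = specᵉ (substᵉ universal (specIndexᵉ universal d)) e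

eval-compIndexᵉ : ∀ {n} (d e : Exp n) g ρ → eval (compIndexᵉ d e) g ρ ≡ compIndex (eval d g ρ) (eval e g ρ)
eval-compIndexᵉ d e g ρ =
  eval-specᵉ {e = substᵉ universal (specIndexᵉ universal d)} {a = e}
    (eval-substᵉ universal {e = specIndexᵉ universal d} (eval-specIndexᵉ universal d g ρ))

compIndex↦ : ∀ {x y z d e} → Φ d at x ↦ y → Φ e at y ↦ z → Φ (compIndex d e) at x ↦ z
compIndex↦ p q n = index⇓ _ (spec⇓ ([]⇓ (λ i → spec⇓ (universal⇓ (p i))) (universal⇓ (q n))))

viaIndex : Code → ℕ → ℕ
viaIndex q d = specIndex (universal [ q ]) d

viaIndex↦ : ∀ {x y z q d} → x ⊩ q ↦ y → Φ d at y ↦ z → Φ (viaIndex q d) at x ↦ z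
viaIndex↦ p r n = index⇓ _ (spec⇓ ([]⇓ p (universal⇓ (r n))))

index↦ : ∀ {x z} c → x ⊩ c ↦ z → Φ (index c) at x ↦ z
index↦ c p n = index⇓ c (p n)

computes-index : ∀ {ψ} c → (∀ σ → (λ _ → 0) ⊢ c · encodeString σ ⇓ ψ σ) → Learner ψ
computes-index c h = index c , λ σ → index⇓ c (h σ)

-- Reductions without partial functions

EM : Set₂
EM = ExcludedMiddle (lsuc 0ℓ)

em₀ : EM → (P : Set) → Dec P
em₀ em P = map′ lower lift (em {Lift (lsuc 0ℓ) P})

least : EM → (P : ℕ → Set) → ∀ {n} → P n → ∃[ m ] m ≤ n × P m × (∀ k → k < m → ¬ P k)
least em P {n} pn = search n 0 (λ _ ()) (≤-reflexive (+-identityʳ n)) (subst P (sym (+-identityʳ n)) pn)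
  where
  search : ∀ k i → (∀ j → j < i → ¬ P j) → k + i ≤ n → P (k + i) → ∃[ m ] m ≤ n × P m × (∀ k → k < m → ¬ P k)
  search k i below le p with em₀ em (P i)
  ... | yes pi = i , m+n≤o⇒n≤o k le , pi , below
  search zero    i below le p | no ¬pi = contradiction p ¬pi
  search (suc k) i below le p | no ¬pi =
    search k (suc i) below′ (subst (_≤ n) (sym (+-suc k i)) le) (subst P (sym (+-suc k i)) p)
    where
    below′ : ∀ j → j < suc i → ¬ P j
    below′ j j<si with m≤n⇒m<n∨m≡n (s≤s⁻¹ j<si)
    ... | inj₁ j<i  = below j j<i
    ... | inj₂ refl = ¬pi

Lim : (List ℕ → ℕ) → Baire → ℕ → Set
Lim ψ x d = (λ n → ψ (x ↾ n)) convergesTo d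

Lim-unique : ∀ {s d d′} → s convergesTo d → s convergesTo d′ → d ≡ d′
Lim-unique (N , h) (N′ , h′) = trans (sym (h _ (m≤m⊔n N N′))) (h′ _ (m≤n⊔m N N′))

↾-cong : ∀ {x x′ : Baire} → x ≗ x′ → ∀ n → x ↾ n ≡ x′ ↾ n
↾-cong e n = applyUpTo-≈ n λ i _ → e i

Lim-resp : ∀ {ψ x x′ d} → x ≗ x′ → Lim ψ x d → Lim ψ x′ d
Lim-resp {ψ} e (N , h) = N , λ n N≤n → trans (cong ψ (sym (↾-cong e n))) (h n N≤n)

Lim-≗ : ∀ {ψ ψ′ x d} → ψ ≗ ψ′ → Lim ψ x d → Lim ψ′ x d
Lim-≗ e (N , h) = N , λ n N≤n → trans (sym (e _)) (h n N≤n)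

Φ-functional : ∀ {e x x′ z z′} → x ≗ x′ → Φ e at x ↦ z → Φ e at x′ ↦ z′ → z ≗ z′
Φ-functional e p q n = ⇓-deterministic e (p n) (q n)

Φ-resp : ∀ {e x x′ z} → x ≗ x′ → Φ e at x ↦ z → Φ e at x′ ↦ z
Φ-resp e p n = ⇓-resp-≗ e (p n)

Φ-resp₂ : ∀ {e x x′ z z′} → x ≗ x′ → z ≗ z′ → Φ e at x ↦ z → Φ e at x′ ↦ z′
Φ-resp₂ {e} x≗x′ z≗z′ p = proj₁ (PartialFunction.respects (Φ e)) z≗z′ (Φ-resp {e} x≗x′ p)

Learned : (List ℕ → ℕ) → Baire → Baire → Set
Learned ψ x z = ∃[ d ] (Lim ψ x d × Φ d at x ↦ z)

Learned-functional : ∀ {ψ ψ′ x x′ z z′} → ψ ≗ ψ′ → x ≗ x′ → Learned ψ x z → Learned ψ′ x′ z′ → z ≗ z′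
Learned-functional {ψ} {z = z} ψ≗ψ′ x≗x′ (d , lim , p) (d′ , lim′ , p′) =
  Φ-functional {d′} x≗x′ (subst (λ d → Φ d at _ ↦ z)
    (Lim-unique (Lim-≗ ψ≗ψ′ (Lim-resp {ψ} x≗x′ lim)) lim′) p) p′

Learned-resp : ∀ {ψ x x′ z z′} → x ≗ x′ → z ≗ z′ → Learned ψ x z → Learned ψ x′ z′
Learned-resp {ψ} x≗x′ z≗z′ (d , lim , p) = d , Lim-resp {ψ} x≗x′ lim , Φ-resp₂ {d} x≗x′ z≗z′ p

LearnBy : ℕ → Baire → Baire → Set
LearnBy e x z = ∃[ ψ ] (e computes ψ × Learned ψ x z)

computes-unique : ∀ {e ψ ψ′} → e computes ψ → e computes ψ′ → ψ ≗ ψ′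
computes-unique c c′ σ = ⇓-deterministic (λ _ → refl) (c σ) (c′ σ)

LearnBy-functional : ∀ {e x x′ z z′} → x ≗ x′ → LearnBy e x z → LearnBy e x′ z′ → z ≗ z′
LearnBy-functional {e} x≗x′ (ψ , c , l) (ψ′ , c′ , l′) =
  Learned-functional (computes-unique {e} {ψ} {ψ′} c c′) x≗x′ l l′

LearnBy-resp₂ : ∀ {e x x′ z z′} → x ≗ x′ → z ≗ z′ → LearnBy e x z → LearnBy e x′ z′
LearnBy-resp₂ x≗x′ z≗z′ (ψ , c , l) = ψ , c , Learned-resp {ψ} x≗x′ z≗z′ l

Hit : Subset → (Baire → Set) → Set
Hit A P = ∃[ z ] (P z × z ∈ˢ A)

-- The content of A ≤[ ν ] B without the partial function.
Red : Notion → Subset → Subset → Set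
Red ⟨1,1⟩ A B = ∃[ e ] ∀ x → x ∈ˢ B → Hit A (λ z → Φ e at x ↦ z)
Red ⟨1,<ω⟩ A B =
  ∃[ ψ ] (Learner ψ × (∀ x → x ∈ˢ B → ∃[ d ] (Lim ψ x d × Hit A (λ z → Φ d at x ↦ z))) ×
    (∃[ k ] (∀ x → x ∈ˢ B → # MindChange ψ x ≤ k)))
Red ⟨1,ω|<ω⟩ A B =
  ∃[ ψ ] (Learner ψ × (∀ x → x ∈ˢ B → ∃[ d ] (Lim ψ x d × Hit A (λ z → Φ d at x ↦ z))) ×
    (∃[ k ] (∀ x → x ∈ˢ B → # Guess ψ x ≤ k)))
Red ⟨1,ω⟩ A B =
  ∃[ ψ ] (Learner ψ × (∀ x → x ∈ˢ B → ∃[ d ] (Lim ψ x d × Hit A (λ z → Φ d at x ↦ z))))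
Red ⟨<ω,1⟩ A B = ∃[ b ] ∀ x → x ∈ˢ B → ∃[ e ] (e < b × Hit A (λ z → Φ e at x ↦ z))
Red ⟨<ω,ω⟩ A B = ∃[ b ] ∀ x → x ∈ˢ B → ∃[ e ] (e < b × Hit A (LearnBy e x))
Red ⟨ω,1⟩ A B = ∀ x → x ∈ˢ B → Hit A (λ z → z ≤ᵀ x)

module _ {A B : Subset} where

  value : ∀ (Γ : PartialFunction) → (∀ g → g ∈ˢ B → Dom Γ g) → (∀ g f → g ∈ˢ B → Γ at g ↦ f → f ∈ˢ A) →
          ∀ d {x} → x ∈ˢ B → Φ d ≃ Γ at x → Hit A (λ z → Φ d at x ↦ z)
  value Γ dom val d x∈B eq with dom _ x∈B
  ... | z , Γxz = z , Equivalence.from (eq z) Γxz , val _ z x∈B Γxz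

  learned : ∀ ψ (Γ : PartialFunction) → (∀ g → g ∈ˢ B → Dom Γ g) → (∀ g f → g ∈ˢ B → Γ at g ↦ f → f ∈ˢ A) →
            ψ identifies Γ → ∀ x → x ∈ˢ B → ∃[ d ] (Lim ψ x d × Hit A (λ z → Φ d at x ↦ z))
  learned ψ Γ dom val ident x x∈B with ident x (dom x x∈B)
  ... | d , lim , eq = d , lim , value Γ dom val d x∈B eq

  ≤⇒Red : ∀ ν → A ≤[ ν ] B → Red ν A B
  ≤⇒Red ⟨1,1⟩ (Γ , (e , eq) , dom , val) = e , λ x x∈B →
    let z , Γxz = dom x x∈B in z , Equivalence.to (eq x z) Γxz , val x z x∈B Γxz
  ≤⇒Red ⟨1,<ω⟩ (Γ , (ψ , l , ident , k , bound) , dom , val) =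
    ψ , l , learned ψ Γ dom val ident , k , λ x x∈B → bound x (dom x x∈B)
  ≤⇒Red ⟨1,ω|<ω⟩ (Γ , (ψ , l , ident , k , bound) , dom , val) =
    ψ , l , learned ψ Γ dom val ident , k , λ x x∈B → bound x (dom x x∈B)
  ≤⇒Red ⟨1,ω⟩ (Γ , (ψ , l , ident) , dom , val) = ψ , l , learned ψ Γ dom val ident
  ≤⇒Red ⟨<ω,1⟩ (Γ , (b , h) , dom , val) = b , λ x x∈B →
    let e , e<b , eq = h x (dom x x∈B)
        z , Γxz = dom x x∈B
    in e , e<b , z , Equivalence.to (eq z) Γxz , val x z x∈B Γxz
  ≤⇒Red ⟨<ω,ω⟩ (Γ , (b , h) , dom , val) = b , λ x x∈B →
    let e , e<b , ψ , comp-ψ , d , lim , eq = h x (dom x x∈B)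
        z , hit , z∈A = value Γ dom val d x∈B eq
    in e , e<b , z , (ψ , comp-ψ , d , lim , hit) , z∈A
  ≤⇒Red ⟨ω,1⟩ (Γ , comp-Γ , dom , val) = λ x x∈B →
    let z , Γxz = dom x x∈B in z , comp-Γ x z Γxz , val x z x∈B Γxz

  same-value : ∀ {Γ Δ : PartialFunction} {x z} → Γ at x ↦ z → Δ at x ↦ z → Γ ≃ Δ at x
  same-value {Γ} {Δ} p q f = mk⇔
    (λ r → proj₁ (PartialFunction.respects Δ) (PartialFunction.functional Γ p r) q)
    (λ r → proj₁ (PartialFunction.respects Γ) (PartialFunction.functional Δ q r) p)

  module Selection (em : EM) (R : ℕ → Baire → Baire → Set)
    (R-functional : ∀ {e x x′ z z′} → x ≗ x′ → R e x z → R e x′ z′ → z ≗ z′)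
    (R-resp : ∀ {e x x′ z z′} → x ≗ x′ → z ≗ z′ → R e x z → R e x′ z′)
    where

    Selected : Baire → Baire → ℕ → Set
    Selected x z e = R e x z × z ∈ˢ A × (∀ i → i < e → ¬ Hit A (R i x))

    -- Insisting on the first realizer that hits A makes the value unique.
    selection : PartialFunction
    selection = record
      -- The domain stays inside B, so bounds known on B hold on all of it.
      { _↦_ = λ x z → x ∈ˢ B × (∃[ e ] Selected x z e)
      ; functional = functional
      ; respects = (λ { z≗z′ (x∈B , e , r , z∈A , first) →
                        x∈B , e , R-resp (λ _ → refl) z≗z′ r , Subset.respects A z≗z′ z∈A , first })
                 , (λ { x≗x′ (x∈B , e , r , z∈A , first) →
                        Subset.respects B x≗x′ x∈B , e , R-resp x≗x′ (λ _ → refl) r , z∈A ,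
                        λ { i i<e (z′ , r′ , z′∈A) → first i i<e (z′ , R-resp (sym ∘ x≗x′) (λ _ → refl) r′ , z′∈A) } })
      }
      where
      functional : ∀ {x z z′} → x ∈ˢ B × (∃[ e ] Selected x z e) → x ∈ˢ B × (∃[ e ] Selected x z′ e) → z ≗ z′
      functional (_ , e , r , z∈A , first) (_ , e′ , r′ , z′∈A , first′) with <-cmp e e′
      ... | tri< e<e′ _ _ = contradiction (_ , r , z∈A) (first′ e e<e′)
      ... | tri≈ _ refl _ = R-functional (λ _ → refl) r r′
      ... | tri> _ _ e′<e = contradiction (_ , r′ , z′∈A) (first e′ e′<e)

    select : ∀ {x e} → x ∈ˢ B → Hit A (R e x) → ∃[ e′ ] ∃[ z ] (e′ ≤ e × R e′ x z × selection at x ↦ z)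
    select {x} {e} x∈B hit with least em (λ e → Hit A (R e x)) hit
    ... | m , m≤e , (z , r , z∈A) , first = m , z , m≤e , r , x∈B , m , r , z∈A , first

    selection-hits : ∀ g f → g ∈ˢ B → selection at g ↦ f → f ∈ˢ A
    selection-hits g f _ (_ , _ , _ , f∈A , _) = f∈A

  module _ (em : EM) where

    private
      module ByLearner (ψ : List ℕ → ℕ) (h : ∀ x → x ∈ˢ B → ∃[ d ] (Lim ψ x d × Hit A (λ z → Φ d at x ↦ z))) where
        open Selection em (λ _ → Learned ψ) (Learned-functional {ψ} (λ _ → refl)) (Learned-resp {ψ}) public

        dom : ∀ x → x ∈ˢ B → Dom selection x
        dom x x∈B with h x x∈B
        ... | d , lim , z , p , z∈A = let _ , z′ , _ , _ , s = select {e = 0} x∈B (z , (d , lim , p) , z∈A) in z′ , s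

        ident : ψ identifies selection
        ident x (z , s@(_ , _ , (d , lim , p) , _)) = d , lim , same-value {Φ d} {selection} p s

      module ByProgram = Selection em (λ e x z → Φ e at x ↦ z) (λ {e} → Φ-functional {e}) (λ {e} → Φ-resp₂ {e})

      module ByLearners = Selection em LearnBy (λ {e} → LearnBy-functional {e}) (λ {e} → LearnBy-resp₂ {e})

    Red⇒≤ : ∀ ν → Red ν A B → A ≤[ ν ] B
    -- A computable function must agree with some `Φ e` everywhere, domain included; so `Φ e` itself
    -- is taken instead of a selection.
    Red⇒≤ ⟨1,1⟩ (e , h) = Φ e , (e , λ g f → mk⇔ (λ p → p) (λ p → p)) ,
      (λ x x∈B → let z , p , _ = h x x∈B in z , p) ,
      (λ x f x∈B p → let z , q , z∈A = h x x∈B in Subset.respects A (Φ-functional {e} (λ _ → refl) q p) z∈A)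
    Red⇒≤ ⟨1,<ω⟩ (ψ , l , h , k , bound) =
      selection , (ψ , l , ident , k , λ { x (_ , x∈B , _) → bound x x∈B }) , dom , selection-hits
      where open ByLearner ψ h
    Red⇒≤ ⟨1,ω|<ω⟩ (ψ , l , h , k , bound) =
      selection , (ψ , l , ident , k , λ { x (_ , x∈B , _) → bound x x∈B }) , dom , selection-hits
      where open ByLearner ψ h
    Red⇒≤ ⟨1,ω⟩ (ψ , l , h) = selection , (ψ , l , ident) , dom , selection-hits
      where open ByLearner ψ h
    Red⇒≤ ⟨<ω,1⟩ (b , h) = selection , (b , computable) , dom , selection-hits
      where
      open ByProgram
      dom : ∀ x → x ∈ˢ B → Dom selection x
      dom x x∈B = let e , _ , hit = h x x∈B ; _ , z , _ , _ , s = select {e = e} x∈B hit in z , s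
      computable : ∀ x → Dom selection x → ∃[ e ] (e < b × (selection ≃ Φ e at x))
      computable x (_ , x∈B , _) =
        let e , e<b , hit = h x x∈B
            e′ , z , e′≤e , r , s = select {e = e} x∈B hit
        in e′ , ≤-<-trans e′≤e e<b , same-value {selection} {Φ e′} s r
    Red⇒≤ ⟨<ω,ω⟩ (b , h) = selection , (b , computable) , dom , selection-hits
      where
      open ByLearners
      dom : ∀ x → x ∈ˢ B → Dom selection x
      dom x x∈B = let e , _ , hit = h x x∈B ; _ , z , _ , _ , s = select {e = e} x∈B hit in z , s
      computable : ∀ x → Dom selection x → ∃[ e ] (e < b × (∃[ ψ ] (e computes ψ × ψ identifies selection on x)))
      computable x (_ , x∈B , _) =
        let e , e<b , hit = h x x∈B
            e′ , z , e′≤e , (ψ , c , d , lim , p) , s = select {e = e} x∈B hit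
        in e′ , ≤-<-trans e′≤e e<b , ψ , c , d , lim , same-value {Φ d} {selection} p s
    Red⇒≤ ⟨ω,1⟩ h = selection , (λ { x z (_ , e , r , _) → e , r }) , dom , selection-hits
      where
      open ByProgram
      dom : ∀ x → x ∈ˢ B → Dom selection x
      dom x x∈B = let z , (e , p) , z∈A = h x x∈B
                      _ , z′ , _ , _ , s = select {e = e} x∈B (z , p , z∈A)
                  in z′ , s

-- Products as joins of degrees

_⊗ˢ_ : Subset → Subset → Subset
A ⊗ˢ B = record
  { Member   = λ x → (p₁ ∘ x) ∈ˢ A × (p₂ ∘ x) ∈ˢ B
  ; respects = λ { e (a , b) → Subset.respects A (cong p₁ ∘ e) a , Subset.respects B (cong p₂ ∘ e) b }
  }

⊕∈⊗ˢ : ∀ {A B y z} → y ∈ˢ A → z ∈ˢ B → (y ⊕ z) ∈ˢ (A ⊗ˢ B)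
⊕∈⊗ˢ {A} {B} y∈A z∈B =
  Subset.respects A (λ n → sym (p₁-⊗ _ _)) y∈A , Subset.respects B (λ n → sym (p₂-⊗ _ _)) z∈B

computable⇒Red : ∀ {A B} ν → Red ⟨1,1⟩ A B → Red ν A B
computable⇒Red {A} {B} = go
  where
  constant : ∀ e → index (const e) computes (λ _ → e)
  constant e σ = index⇓ (const e) (const⇓ e)
  limit : ∀ {e x} → Hit A (λ z → Φ e at x ↦ z) → ∃[ d ] (Lim (λ _ → e) x d × Hit A (λ z → Φ d at x ↦ z))
  limit {e} hit = e , (0 , λ _ _ → refl) , hit
  go : ∀ ν → Red ⟨1,1⟩ A B → Red ν A B
  go ⟨1,1⟩ r = r
  go ⟨1,<ω⟩ (e , h) =
    (λ _ → e) , (index (const e) , constant e) , (λ x x∈B → limit {e} (h x x∈B)) ,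
    0 , λ _ _ → [] , z≤n , λ n ch → contradiction refl ch
  go ⟨1,ω|<ω⟩ (e , h) =
    (λ _ → e) , (index (const e) , constant e) , (λ x x∈B → limit {e} (h x x∈B)) ,
    1 , λ _ _ → e ∷ [] , ≤-refl , λ { n (_ , refl) → here refl }
  go ⟨1,ω⟩ (e , h) = (λ _ → e) , (index (const e) , constant e) , (λ x x∈B → limit {e} (h x x∈B))
  go ⟨<ω,1⟩ (e , h) = suc e , λ x x∈B → e , ≤-refl , h x x∈B
  go ⟨<ω,ω⟩ (e , h) = suc (index (const e)) , λ x x∈B →
    let z , p , z∈A = h x x∈B
    in index (const e) , ≤-refl , z , ((λ _ → e) , constant e , e , (0 , λ _ _ → refl) , p) , z∈A
  go ⟨ω,1⟩ (e , h) = λ x x∈B → let z , p , z∈A = h x x∈B in z , (e , p) , z∈A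

Red-fst : ∀ {A B} ν → Red ν A (A ⊗ˢ B)
Red-fst ν = computable⇒Red ν (index (comp fst oracle) , λ x x∈ →
  (p₁ ∘ x) , index↦ (comp fst oracle) (λ n → comp oracle ft⇓) , proj₁ x∈)

Red-snd : ∀ {A B} ν → Red ν B (A ⊗ˢ B)
Red-snd ν = computable⇒Red ν (index (comp snd oracle) , λ x x∈ →
  (p₂ ∘ x) , index↦ (comp snd oracle) (λ n → comp oracle sd⇓) , proj₂ x∈)

Red⇒≤ᵀ : ∀ {A B} ν → Red ν A B → ∀ x → x ∈ˢ B → ∃[ z ] (z ≤ᵀ x × z ∈ˢ A)
Red⇒≤ᵀ ⟨1,1⟩ (e , h) x x∈B = let z , p , z∈A = h x x∈B in z , (e , p) , z∈A
Red⇒≤ᵀ ⟨1,<ω⟩ (ψ , _ , h , _) x x∈B = let d , _ , z , p , z∈A = h x x∈B in z , (d , p) , z∈A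
Red⇒≤ᵀ ⟨1,ω|<ω⟩ (ψ , _ , h , _) x x∈B = let d , _ , z , p , z∈A = h x x∈B in z , (d , p) , z∈A
Red⇒≤ᵀ ⟨1,ω⟩ (ψ , _ , h) x x∈B = let d , _ , z , p , z∈A = h x x∈B in z , (d , p) , z∈A
Red⇒≤ᵀ ⟨<ω,1⟩ (b , h) x x∈B = let e , _ , z , p , z∈A = h x x∈B in z , (e , p) , z∈A
Red⇒≤ᵀ ⟨<ω,ω⟩ (b , h) x x∈B = let e , _ , z , (_ , _ , d , _ , p) , z∈A = h x x∈B in z , (d , p) , z∈A
Red⇒≤ᵀ ⟨ω,1⟩ h = h

pairLearner : (ψ χ : List ℕ → ℕ) → List ℕ → ℕ
pairLearner ψ χ σ = pairIndex (ψ σ) (χ σ)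

pairProgram : ℕ → ℕ → ℕ
pairProgram e e′ = index (comp (fn (specIndexᵉ pairU #0)) (pair (decode e) (decode e′)))

pairProgram-computes : ∀ {e e′ ψ χ} → e computes ψ → e′ computes χ → pairProgram e e′ computes pairLearner ψ χ
pairProgram-computes {ψ = ψ} {χ} c c′ σ = index⇓ _ (comp (pair⇓ (c σ) (c′ σ))
  (⇓≡ (fn⇓ (specIndexᵉ pairU #0) _) (eval-specIndexᵉ pairU #0 (λ _ → 0) (ψ σ ⊗ χ σ ∷ []))))

pairLearner-Lim : ∀ {ψ χ x d e} → Lim ψ x d → Lim χ x e → Lim (pairLearner ψ χ) x (pairIndex d e)
pairLearner-Lim (N , h) (N′ , h′) = N ⊔ N′ , λ n le →
  cong₂ pairIndex (h n (m⊔n≤o⇒m≤o N N′ le)) (h′ n (m⊔n≤o⇒n≤o N N′ le))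

length-cartesianProductWith : ∀ {A B C : Set} (f : A → B → C) xs ys →
  length (cartesianProductWith f xs ys) ≡ length xs * length ys
length-cartesianProductWith f []       ys = refl
length-cartesianProductWith f (x ∷ xs) ys = trans (length-++ (map (f x) ys))
  (cong₂ _+_ (length-map (f x) ys) (length-cartesianProductWith f xs ys))

bounded₂ : (f : ℕ → ℕ → ℕ) → ∀ b c → ∃[ M ] ∀ i → i < b → ∀ j → j < c → f i j < M
bounded₂ f b c = bounded-sup (λ le h j j<c → <-≤-trans (h j j<c) le) b λ i _ →
  bounded-sup (λ le lt → <-≤-trans lt le) c λ j _ → suc (f i j) , ≤-refl

-- Both reductions run side by side: mind changes add, guesses multiply, and finitely many pairs of
-- numbers have bounded pair programs.
Red-pair : ∀ {A C X} ν → Red ν A X → Red ν C X → Red ν (A ⊗ˢ C) X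
Red-pair {A} {C} {X} = go
  where
  hits : ∀ {x d e} → Hit A (λ z → Φ d at x ↦ z) → Hit C (λ z → Φ e at x ↦ z) →
         Hit (A ⊗ˢ C) (λ z → Φ (pairIndex d e) at x ↦ z)
  hits {d = d} {e} (y , p , y∈A) (z , q , z∈C) =
    (y ⊕ z) , pairIndex↦ {d = d} {e} p q , ⊕∈⊗ˢ {A} {C} y∈A z∈C
  limits : ∀ {ψ χ x} → ∃[ d ] (Lim ψ x d × Hit A (λ z → Φ d at x ↦ z)) →
           ∃[ d ] (Lim χ x d × Hit C (λ z → Φ d at x ↦ z)) →
           ∃[ d ] (Lim (pairLearner ψ χ) x d × Hit (A ⊗ˢ C) (λ z → Φ d at x ↦ z))
  limits {ψ} {χ} (d , lim , hit) (e , lim′ , hit′) =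
    pairIndex d e , pairLearner-Lim {ψ} {χ} lim lim′ , hits {d = d} {e} hit hit′
  learner : ∀ {ψ χ} → Learner ψ → Learner χ → Learner (pairLearner ψ χ)
  learner {ψ} {χ} (e , c) (e′ , c′) = pairProgram e e′ , pairProgram-computes {e} {e′} {ψ} {χ} c c′
  go : ∀ ν → Red ν A X → Red ν C X → Red ν (A ⊗ˢ C) X
  go ⟨1,1⟩ (d , h) (e , h′) = pairIndex d e , λ x x∈X → hits {d = d} {e} (h x x∈X) (h′ x x∈X)
  go ⟨1,<ω⟩ (ψ , l , h , k , bound) (χ , l′ , h′ , k′ , bound′) =
    pairLearner ψ χ , learner l l′ , (λ x x∈X → limits {ψ} {χ} (h x x∈X) (h′ x x∈X)) , k + k′ , changes
    where
    changes : ∀ x → x ∈ˢ X → # MindChange (pairLearner ψ χ) x ≤ (k + k′)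
    changes x x∈X with bound x x∈X | bound′ x x∈X
    ... | xs , len , mem | ys , len′ , mem′ =
      xs ++ ys , subst (_≤ k + k′) (sym (length-++ xs)) (+-mono-≤ len len′) , member
      where
      member : ∀ n → MindChange (pairLearner ψ χ) x n → n ∈ xs ++ ys
      member n ch with ψ (x ↾ suc n) ≟ ψ (x ↾ n) | χ (x ↾ suc n) ≟ χ (x ↾ n)
      ... | no c  | _      = ∈-++⁺ˡ (mem n c)
      ... | yes _ | no c   = ∈-++⁺ʳ xs (mem′ n c)
      ... | yes p | yes q  = contradiction (cong₂ pairIndex p q) ch
  go ⟨1,ω|<ω⟩ (ψ , l , h , k , bound) (χ , l′ , h′ , k′ , bound′) =
    pairLearner ψ χ , learner l l′ , (λ x x∈X → limits {ψ} {χ} (h x x∈X) (h′ x x∈X)) , k * k′ , guesses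
    where
    guesses : ∀ x → x ∈ˢ X → # Guess (pairLearner ψ χ) x ≤ (k * k′)
    guesses x x∈X with bound x x∈X | bound′ x x∈X
    ... | xs , len , mem | ys , len′ , mem′ =
      cartesianProductWith pairIndex xs ys ,
      subst (_≤ k * k′) (sym (length-cartesianProductWith pairIndex xs ys)) (*-mono-≤ len len′) ,
      λ { d (n , refl) → ∈-cartesianProductWith⁺ pairIndex (mem _ (n , refl)) (mem′ _ (n , refl)) }
  go ⟨1,ω⟩ (ψ , l , h) (χ , l′ , h′) =
    pairLearner ψ χ , learner l l′ , λ x x∈X → limits {ψ} {χ} (h x x∈X) (h′ x x∈X)
  go ⟨<ω,1⟩ (b , h) (c , h′) with bounded₂ pairIndex b c
  ... | M , below = M , λ x x∈X →
    let d , d<b , hit = h x x∈X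
        e , e<c , hit′ = h′ x x∈X
    in pairIndex d e , below d d<b e e<c , hits {d = d} {e} hit hit′
  go ⟨<ω,ω⟩ (b , h) (c , h′) with bounded₂ pairProgram b c
  ... | M , below = M , λ x x∈X →
    let d , d<b , y , (ψ , comp-ψ , i , lim , p) , y∈A = h x x∈X
        e , e<c , z , (χ , comp-χ , j , lim′ , q) , z∈C = h′ x x∈X
    in pairProgram d e , below d d<b e e<c , (y ⊕ z) ,
       (pairLearner ψ χ , pairProgram-computes {d} {e} {ψ} {χ} comp-ψ comp-χ ,
        pairIndex i j , pairLearner-Lim {ψ} {χ} lim lim′ , pairIndex↦ {d = i} {j} p q) ,
       ⊕∈⊗ˢ {A} {C} y∈A z∈C
  go ⟨ω,1⟩ h h′ x x∈X =
    let y , (d , p) , y∈A = h x x∈X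
        z , (e , q) , z∈C = h′ x x∈X
    in (y ⊕ z) , (pairIndex d e , pairIndex↦ {d = d} {e} p q) , ⊕∈⊗ˢ {A} {C} y∈A z∈C

-- Composition of learners

-- The input is z ⊗ d; z also serves as the number of steps.
prefixᵉ : Exp 1
prefixᵉ = lt (ft #0) (lt (sd #1) (rec #1 ze
  (lt (#3 ∸ᵉ su #0) (lt #3 (lt #5 (lt #6 (rec Evalᵉ ze (su (#0 ⊗ᵉ #7)))))))))

-- Positions are visited downwards from z - 1, and a position without a value resets the string.
-- What survives is the longest initial segment of values found.
prefixStep : ℕ → ℕ → ℕ → List ℕ → List ℕ
prefixStep z d k r = natrec [] (λ v _ → v ∷ r) (Evalℕ z z d (z ∸ suc k))

prefix : ℕ → ℕ → ℕ → List ℕ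
prefix z d = natrec [] (prefixStep z d)

eval-prefixᵉ : ∀ g z d → eval prefixᵉ g (z ⊗ d ∷ []) ≡ encodeString (prefix z d z)
eval-prefixᵉ g z d rewrite p₁-⊗ z d | p₂-⊗ z d = go z
  where
  step-eq : ∀ k r → natrec 0 (λ v _ → suc (v ⊗ encodeString r)) (Evalℕ z z d (z ∸ suc k)) ≡ encodeString (prefixStep z d k r)
  step-eq k r with Evalℕ z z d (z ∸ suc k)
  ... | zero  = refl
  ... | suc v = cong suc (⊗≡⟨,⟩ v _)
  body : ℕ → ℕ → ℕ
  body k r = eval (lt (#3 ∸ᵉ su #0) (lt #3 (lt #5 (lt #6 (rec Evalᵉ ze (su (#0 ⊗ᵉ #7))))))) g
                  (k ∷ r ∷ d ∷ z ∷ z ⊗ d ∷ [])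
  body-eq : ∀ k r → body k r ≡ natrec 0 (λ v _ → suc (v ⊗ r)) (Evalℕ z z d (z ∸ suc k))
  body-eq k r = cong (natrec 0 (λ v _ → suc (v ⊗ r))) (Eval-Evalᵉ g z z d (z ∸ suc k) (d ∷ z ∸ suc k ∷ k ∷ r ∷ d ∷ z ∷ z ⊗ d ∷ []))
  go : ∀ k → natrec 0 body k ≡ encodeString (prefix z d k)
  go zero    = refl
  go (suc k) = trans (cong (body k) (go k)) (trans (body-eq k _) (step-eq k (prefix z d k)))

-- Invariant: after k rounds the string is a block of y that starts at `z ∸ k` and reaches up to M
-- at least. Resets occur only at positions from M on.
prefix-↾ : ∀ {z d M} {y : Baire} → M ≤ z →
           (∀ p {v} → Evalℕ z z d p ≡ suc v → v ≡ y p) →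
           (∀ p → p < M → Evalℕ z z d p ≡ suc (y p)) →
           ∃[ l ] M ≤ l × prefix z d z ≡ y ↾ l
prefix-↾ {z} {d} {M} {y} M≤z sound complete =
  let l , eq , M≤ = go z ≤-refl
  in l , subst (λ t → M ≤ t + l) (n∸n≡0 z) M≤ ,
     trans eq (applyUpTo-≈ l λ i _ → cong (λ t → y (t + i)) (n∸n≡0 z))
  where
  go : ∀ k → k ≤ z → ∃[ l ] prefix z d k ≡ (λ i → y (z ∸ k + i)) ↾ l × M ≤ z ∸ k + l
  go zero    _   = 0 , refl , ≤-trans M≤z (≤-reflexive (sym (+-identityʳ z)))
  go (suc k) k<z with go k (<⇒≤ k<z)
  ... | l , eq , M≤ = extend (Evalℕ z z d (z ∸ suc k)) refl
    where
    next : z ∸ k ≡ suc (z ∸ suc k)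
    next = +-∸-assoc 1 k<z
    shift : ∀ i → z ∸ k + i ≡ z ∸ suc k + suc i
    shift i = trans (cong (_+ i) next) (sym (+-suc (z ∸ suc k) i))
    extend : ∀ v → Evalℕ z z d (z ∸ suc k) ≡ v →
             ∃[ l ] natrec [] (λ v _ → v ∷ prefix z d k) (Evalℕ z z d (z ∸ suc k)) ≡ (λ i → y (z ∸ suc k + i)) ↾ l
                    × M ≤ z ∸ suc k + l
    extend zero ev≡ = 0 , cong (natrec [] (λ v _ → v ∷ prefix z d k)) ev≡ ,
      subst (M ≤_) (sym (+-identityʳ _)) (≮⇒≥ λ p<M → contradiction (trans (sym ev≡) (complete _ p<M)) λ ())
    extend (suc v) ev≡ = suc l ,
      trans (cong (natrec [] (λ v _ → v ∷ prefix z d k)) ev≡)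
        (cong₂ _∷_ (trans (sound _ ev≡) (cong y (sym (+-identityʳ _))))
                   (trans eq (applyUpTo-≈ l λ i _ → cong y (shift i)))) ,
      subst (M ≤_) (shift l) M≤

compLearner : (ψ χ : List ℕ → ℕ) → List ℕ → ℕ
compLearner ψ χ σ = compIndex (ψ σ) (χ (prefix (encodeString σ) (ψ σ) (encodeString σ)))

compLearner-Learner : ∀ {ψ χ} → Learner ψ → Learner χ → Learner (compLearner ψ χ)
compLearner-Learner {ψ} {χ} (e , c) (e′ , c′) =
  computes-index {compLearner ψ χ} (comp (fn (compIndexᵉ (ft #0) (sd #0)))
      (pair (decode e) (comp (decode e′) (comp (fn prefixᵉ) (pair idc (decode e))))))
    λ σ → comp
      (pair⇓ (c σ) (comp (comp (pair⇓ id⇓ (c σ))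
        (⇓≡ (fn⇓ prefixᵉ _) (eval-prefixᵉ (λ _ → 0) (encodeString σ) (ψ σ)))) (c′ _)))
      (⇓≡ (fn⇓ (compIndexᵉ (ft #0) (sd #0)) _)
        (trans (eval-compIndexᵉ (ft #0) (sd #0) (λ _ → 0) _) (cong₂ compIndex (p₁-⊗ _ _) (p₂-⊗ _ _))))

-- Three thresholds: N for ψ to settle, M for χ to settle on y, and S for program d to halt on all
-- arguments below M. The simulated prefixes need not grow steadily; a length of at least M is
-- enough.
compLearner-Lim : ∀ {ψ χ x y d e} → Lim ψ x d → Φ d at x ↦ y → Lim χ y e →
                  Lim (compLearner ψ χ) x (compIndex d e)
compLearner-Lim {ψ} {χ} {x} {y} {d} {e} (N , ψ≡d) p (M , χ≡e)
  with bounded-sup {λ i S → ∀ s L → S ≤ s → S ≤ L → Evalℕ (encodeString (x ↾ L)) s d i ≡ suc (y i)}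
         (λ le h s L S≤s S≤L → h s L (≤-trans le S≤s) (≤-trans le S≤L)) M (λ i _ → Eval-complete (p i))
... | S , halts = N ⊔ (S ⊔ M) , λ n le →
  let N≤n = m⊔n≤o⇒m≤o N (S ⊔ M) le
      SM≤n = m⊔n≤o⇒n≤o N (S ⊔ M) le
      S≤n = m⊔n≤o⇒m≤o S M SM≤n
      M≤n = m⊔n≤o⇒n≤o S M SM≤n
      z = encodeString (x ↾ n)
      n≤z = length≤code x n
      l , M≤l , pre = prefix-↾ {z} {d} {M} {y} (≤-trans M≤n n≤z) (λ i → Eval-sound (p i) n z)
                        (λ i i<M → halts i i<M z n (≤-trans S≤n n≤z) S≤n)
  in trans (cong (λ d → compIndex d (χ (prefix z d z))) (ψ≡d n N≤n))
           (cong (compIndex d) (trans (cong χ pre) (χ≡e l M≤l)))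

Red-trans-ω : ∀ {A B C} → Red ⟨1,ω⟩ A B → Red ⟨1,ω⟩ B C → Red ⟨1,ω⟩ A C
Red-trans-ω (χ , l′ , h′) (ψ , l , h) = compLearner ψ χ , compLearner-Learner {ψ} {χ} l l′ , λ x x∈C →
  let d , lim , y , p , y∈B = h x x∈C
      e , lim′ , z , q , z∈A = h′ y y∈B
  in compIndex d e , compLearner-Lim {ψ} {χ} {x} {y} lim p lim′ , z , compIndex↦ {d = d} {e} p q , z∈A

-- Residuals

data Brouwerian : Notion → Set where
  ⟨1,1⟩ : Brouwerian ⟨1,1⟩
  ⟨1,ω⟩ : Brouwerian ⟨1,ω⟩
  ⟨ω,1⟩ : Brouwerian ⟨ω,1⟩

Red-trans : ∀ {ν A B C} → Brouwerian ν → Red ν A B → Red ν B C → Red ν A C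
Red-trans ⟨1,1⟩ (e , h′) (d , h) = compIndex d e , λ x x∈C →
  let y , p , y∈B = h x x∈C
      z , q , z∈A = h′ y y∈B
  in z , compIndex↦ {d = d} {e} p q , z∈A
Red-trans {_} {A} {B} {C} ⟨1,ω⟩ r s = Red-trans-ω {A} {B} {C} r s
Red-trans ⟨ω,1⟩ h′ h x x∈C =
  let y , (d , p) , y∈B = h x x∈C
      z , (e , q) , z∈A = h′ y y∈B
  in z , (compIndex d e , compIndex↦ {d = d} {e} p q) , z∈A

p₁⊗p₂ : ∀ n → p₁ n ⊗ p₂ n ≡ n
p₁⊗p₂ n = trans (⊗≡⟨,⟩ _ _) (trans (cong₂ ⟨_,_⟩ (p₁≡π₁ n) (p₂≡π₂ n)) (pair-unpair n))

LearnBy-resp : ∀ {e x x′ z} → x ≗ x′ → LearnBy e x z → LearnBy e x′ z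
LearnBy-resp {e} x≗x′ = LearnBy-resp₂ {e} x≗x′ (λ _ → refl)

≤ᵀ-resp : ∀ {x x′ z} → x ≗ x′ → z ≤ᵀ x → z ≤ᵀ x′
≤ᵀ-resp x≗x′ (e , p) = e , Φ-resp {e} x≗x′ p

⊕-cong : ∀ {f f′ g g′ : Baire} → f ≗ f′ → g ≗ g′ → (f ⊕ g) ≗ (f′ ⊕ g′)
⊕-cong e e′ n = cong₂ _⊗_ (e n) (e′ n)

-- The residual of B by A consists of the reals g together with a realizer e,
-- stored in every entry, that solves B from f ⊕ g for all f in A.
module Implication (R : ℕ → Baire → Baire → Set)
  (R-resp : ∀ {e x x′ z} → x ≗ x′ → R e x z → R e x′ z) (A B : Subset) where

  tagged : ℕ → Baire → Baire
  tagged e g n = e ⊗ g n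

  implication : Subset
  implication = record
    { Member   = λ w → ∀ f → f ∈ˢ A → Hit B (R (p₁ (w 0)) (f ⊕ (p₂ ∘ w)))
    ; respects = λ {w} {w′} w≗w′ h f f∈A → let z , r , z∈B = h f f∈A in
        z , subst (λ v → R (p₁ v) (f ⊕ (p₂ ∘ w′)) z) (w≗w′ 0)
              (R-resp (⊕-cong {f} (λ _ → refl) (cong p₂ ∘ w≗w′)) r) , z∈B
    }

  tagged∈ : ∀ {D e g} → (∀ x → x ∈ˢ (A ⊗ˢ D) → Hit B (R e x)) → g ∈ˢ D → tagged e g ∈ˢ implication
  tagged∈ {D} {e} {g} h g∈D f f∈A = let z , r , z∈B = h (f ⊕ g) (⊕∈⊗ˢ {A} {D} f∈A g∈D) in
    z , R-resp (⊕-cong {f} (λ _ → refl) (λ n → sym (p₂-⊗ e (g n))))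
          (subst (λ e → R e (f ⊕ g) z) (sym (p₁-⊗ e (g 0))) r) , z∈B

  implication≤ : ∀ {D} ν e → (∀ x → x ∈ˢ (A ⊗ˢ D) → Hit B (R e x)) → Red ν implication D
  implication≤ {D} ν e h = computable⇒Red ν (index (pair (const e) oracle) , λ g g∈D →
    tagged e g , index↦ _ (λ n → pair⇓ (const⇓ e) oracle) , tagged∈ {D} h g∈D)

-- The oracle is f ⊕ w with w n = e ⊗ g n.
untagᵉ : ∀ {n} → Exp (1 + n)
untagᵉ = ft (orc #0) ⊗ᵉ sd (sd (orc #0))

untag : Baire → Baire
untag x = (p₁ ∘ x) ⊕ (p₂ ∘ (p₂ ∘ x))

tagᵉ : Exp 1
tagᵉ = ft (sd (orc ze))

lastᵉ : Exp 1
lastᵉ = rec #0 ze (rec (lk #2 #0) #1 #0)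

-- The last entry of the string z: the z rounds pass its end, and lookups beyond the end keep the
-- previous value. The empty string yields 0.
lastℕ : ℕ → ℕ
lastℕ z = natrec 0 (λ k r → natrec r (λ v _ → v) (lkℕ z k)) z

lastℕ-↾ : ∀ y n → lastℕ (encodeString (y ↾ suc n)) ≡ y n
lastℕ-↾ y n = go _ (length≤code y (suc n))
  where
  z = encodeString (y ↾ suc n)
  go : ∀ k → n < k → natrec 0 (λ k r → natrec r (λ v _ → v) (lkℕ z k)) k ≡ y n
  go (suc k) n≤k with m≤n⇒m<n∨m≡n (s≤s⁻¹ n≤k)
  ... | inj₂ refl = cong (natrec _ (λ v _ → v)) (lkℕ-< y ≤-refl)
  ... | inj₁ n<k  = trans (cong (natrec _ (λ v _ → v)) (lkℕ-≥ y n<k)) (go k n<k)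

lastLearner : (ℕ → ℕ) → List ℕ → ℕ
lastLearner h σ = h (lastℕ (encodeString σ))

lastLearner-Learner : ∀ h (e : Exp 1) → (∀ g n → eval e g (n ∷ []) ≡ h n) → Learner (lastLearner h)
lastLearner-Learner h e eq = computes-index {lastLearner h} (comp (fn e) (fn lastᵉ))
  λ σ → comp (fn⇓ lastᵉ _) (⇓≡ (fn⇓ e _) (eq (λ _ → 0) _))

-- Lies between B and A ⊗ˢ implication, and separates taking the limit from the
-- computable part of the reduction.
limits : Subset → Subset
limits B = record
  { Member   = λ y → ∃[ d ] ((p₁ ∘ y) convergesTo d × Hit B (λ z → Φ d at (p₂ ∘ y) ↦ z))
  ; respects = λ { y≗y′ (d , (N , h) , z , p , z∈B) →
      d , (N , λ n N≤n → trans (cong p₁ (sym (y≗y′ n))) (h n N≤n)) ,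
      z , Φ-resp {d} (cong p₂ ∘ y≗y′) p , z∈B }
  }

Red-limits : ∀ B → Red ⟨1,ω⟩ B (limits B)
Red-limits B = lastLearner guess , lastLearner-Learner guess (specIndexᵉ u (ft #0))
    (λ g n → eval-specIndexᵉ u (ft #0) g (n ∷ [])) , reduces
  where
  u = universal [ comp snd oracle ]
  guess : ℕ → ℕ
  guess v = specIndex u (p₁ v)
  reduces : ∀ y → y ∈ˢ limits B → ∃[ d ] (Lim (lastLearner guess) y d × Hit B (λ z → Φ d at y ↦ z))
  reduces y (d , (N , h) , z , p , z∈B) = viaIndex (comp snd oracle) d , (suc N , limit) ,
    z , viaIndex↦ {d = d} (λ n → comp oracle sd⇓) p , z∈B
    where
    -- Entry n is the last one of the prefix of length n + 1, hence the shift by one.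
    limit : ∀ n → suc N ≤ n → lastLearner guess (y ↾ n) ≡ viaIndex (comp snd oracle) d
    limit (suc n) (s≤s N≤n) = trans (cong guess (lastℕ-↾ y n)) (cong (specIndex u) (h n N≤n))

residual : ∀ {ν} → Brouwerian ν → ∀ A B → ∃[ C ] (Red ν B (A ⊗ˢ C) × (∀ D → Red ν B (A ⊗ˢ D) → Red ν C D))
residual ⟨1,1⟩ A B = implication , (index c , reduces) , λ { D (e , h) → implication≤ {D} ⟨1,1⟩ e h }
  where
  open Implication (λ e x z → Φ e at x ↦ z) (λ {e} → Φ-resp {e}) A B
  c : Code
  c = comp (universal [ fn untagᵉ ]) (fn (tagᵉ ⊗ᵉ #0))
  reduces : ∀ x → x ∈ˢ (A ⊗ˢ implication) → Hit B (λ z → Φ (index c) at x ↦ z)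
  reduces x (f∈A , w∈) = let z , p , z∈B = w∈ _ f∈A in
    z , index↦ c (λ n → comp (fn⇓ (tagᵉ ⊗ᵉ #0) n) ([]⇓ (fn⇓ untagᵉ) (universal⇓ (p n)))) , z∈B
residual ⟨1,ω⟩ A B = implication , reduces ,
    λ { D (ψ , (e , c) , h) → implication≤ {D} ⟨1,ω⟩ e λ x x∈ →
          let d , lim , z , p , z∈B = h x x∈ in z , (ψ , c , d , lim , p) , z∈B }
  where
  open Implication LearnBy (λ {e} → LearnBy-resp {e}) A B
  c : Code
  -- Entry n records the guess of the stored learner on the first n untagged entries. Learners run
  -- with the zero oracle, which `universal [ zero ]` supplies.
  c = pair (comp (universal [ zero ]) (fn (tagᵉ ⊗ᵉ tab #0 untagᵉ))) (fn untagᵉ)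
  guesses : Red ⟨1,1⟩ (limits B) (A ⊗ˢ implication)
  guesses = index c , λ x x∈ → to-limits x x∈
    where
    to-limits : ∀ x → x ∈ˢ (A ⊗ˢ implication) → Hit (limits B) (λ y → Φ (index c) at x ↦ y)
    to-limits x (f∈A , w∈) with w∈ _ f∈A
    ... | z , (ψ , comp-ψ , d , (N , lim) , p) , z∈B =
      (λ n → ψ (untag x ↾ n) ⊗ untag x n) ,
      index↦ c (λ n → pair⇓
        (comp (⇓≡ (fn⇓ (tagᵉ ⊗ᵉ tab #0 untagᵉ) n)
                  (cong (p₁ (p₂ (x 0)) ⊗_) (eval-tab #0 untagᵉ x (n ∷ []) (untag x) (λ i k r n → refl))))
              ([]⇓ (λ _ → zero) (universal⇓ (comp-ψ (untag x ↾ n)))))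
        (fn⇓ untagᵉ n)) ,
      d , (N , λ n N≤n → trans (p₁-⊗ _ _) (lim n N≤n)) ,
      z , Φ-resp {d} (λ n → sym (p₂-⊗ _ _)) p , z∈B
  reduces : Red ⟨1,ω⟩ B (A ⊗ˢ implication)
  reduces = Red-trans {⟨1,ω⟩} {B} {limits B} {A ⊗ˢ implication} ⟨1,ω⟩ (Red-limits B)
              (computable⇒Red {limits B} {A ⊗ˢ implication} ⟨1,ω⟩ guesses)
-- Each real may use its own program here, so no realizer is stored and D itself is contained in C.
residual ⟨ω,1⟩ A B = C , reduces , λ D h g g∈D → g , (index oracle , index↦ oracle (λ n → oracle)) ,
    λ f f∈A → h (f ⊕ g) (⊕∈⊗ˢ {A} {D} f∈A g∈D)
  where
  C : Subset
  C = record
    { Member   = λ g → ∀ f → f ∈ˢ A → Hit B (λ z → z ≤ᵀ (f ⊕ g))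
    ; respects = λ g≗g′ h f f∈A → let z , p , z∈B = h f f∈A in
        z , ≤ᵀ-resp (⊕-cong {f} (λ _ → refl) g≗g′) p , z∈B
    }
  reduces : Red ⟨ω,1⟩ B (A ⊗ˢ C)
  reduces x (f∈A , g∈C) = let z , p , z∈B = g∈C _ f∈A in z , ≤ᵀ-resp (λ n → p₁⊗p₂ (x n)) p , z∈B

-- Every a, b have a least c with b ≤ a ∨ c.  Joins are avoided: b ≤ a ∨ c is
-- expressed by quantifying over upper bounds of a and c on the left, and by
-- an element j ≤ a ∨ d above b on the right.
brouwerian : Sentence
brouwerian =
  ∀′ ∀′ ∃′ ( (∀′ (v3 ≼ v0 ⇒′ v1 ≼ v0 ⇒′ v2 ≼ v0))
          ∧′ (∀′ ((∃′ (v3 ≼ v0 ∧′ (∀′ (v5 ≼ v0 ⇒′ v2 ≼ v0 ⇒′ v1 ≼ v0)))) ⇒′ v1 ≼ v0)))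
  where
  v0 : ∀ {n} → Fin (1 + n)
  v0 = zero
  v1 : ∀ {n} → Fin (2 + n)
  v1 = suc v0
  v2 : ∀ {n} → Fin (3 + n)
  v2 = suc v1
  v3 : ∀ {n} → Fin (4 + n)
  v3 = suc v2
  v5 : ∀ {n} → Fin (6 + n)
  v5 = suc (suc v3)

Brouwerian⇒⊨ : EM → ∀ {ν} → Brouwerian ν → 𝓓 ν ⊨ brouwerian
Brouwerian⇒⊨ em {ν} br A B with residual br A B
... | C , B≤A⊗C , minimal = C ,
  (λ X A≤X C≤X → Red⇒≤ em ν (Red-trans {ν} {B} {A ⊗ˢ C} {X} br B≤A⊗C
     (Red-pair {A} {C} {X} ν (≤⇒Red ν A≤X) (≤⇒Red ν C≤X)))) ,
  (λ { D (J , B≤J , least-J) → Red⇒≤ em ν (minimal D (Red-trans {ν} {B} {J} {A ⊗ˢ D} br (≤⇒Red ν B≤J)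
     (≤⇒Red ν (least-J (A ⊗ˢ D) (Red⇒≤ em ν (Red-fst {A} {D} ν)) (Red⇒≤ em ν (Red-snd {A} {D} ν)))))) })

singleton : Baire → Subset
singleton g = record { Member = _≗ g ; respects = λ e p n → trans (sym (e n)) (p n) }

⊭-brouwerian : EM → ∀ ν A B (g : ℕ → Baire) →
  (∀ m → Red ν B (A ⊗ˢ singleton (g m))) →
  (∀ C → (∀ m → ∃[ c ] (c ≤ᵀ g m × c ∈ˢ C)) → ¬ Red ν B (A ⊗ˢ C)) →
  ¬ (𝓓 ν ⊨ brouwerian)
⊭-brouwerian em ν A B g solves fails ⊨b with ⊨b A B
... | C , upper , minimal = fails C
  (λ m → Red⇒≤ᵀ {C} {singleton (g m)} ν (≤⇒Red ν (minimal (singleton (g m))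
     (A ⊗ˢ singleton (g m) , Red⇒≤ em ν (solves m) ,
      λ Y A≤Y D≤Y → Red⇒≤ em ν (Red-pair {A} {singleton (g m)} {Y} ν (≤⇒Red ν A≤Y) (≤⇒Red ν D≤Y)))))
     (g m) (λ _ → refl))
  (≤⇒Red ν (upper (A ⊗ˢ C) (Red⇒≤ em ν (Red-fst {A} {C} ν)) (Red⇒≤ em ν (Red-snd {A} {C} ν))))

-- Independent reals

≈-refl : ∀ {g N} → g ≈[ N ] g
≈-refl n _ = refl

≈-trans : ∀ {f g h N} → f ≈[ N ] g → g ≈[ N ] h → f ≈[ N ] h
≈-trans p q n n<N = trans (p n n<N) (q n n<N)

-- The Baire category theorem, as a construction by finite extensions.
generic : (R : ℕ → Baire → Set) →
          (∀ s g N → ∃[ g′ ] ∃[ N′ ] (g ≈[ N ] g′ × (∀ h → g′ ≈[ N′ ] h → R s h))) →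
          ∃[ G ] ∀ s → R s G
generic R dense = G , meets
  where
  stage : ℕ → Baire × ℕ
  -- `⊔ suc N` makes the lengths strictly increase, so stage n + 1 has fixed entry n.
  stage = natrec ((λ _ → 0) , 0) λ s (g , N) → let g′ , N′ , _ = dense s g N in g′ , N′ ⊔ suc N
  pt : ℕ → Baire
  pt s = proj₁ (stage s)
  len : ℕ → ℕ
  len s = proj₂ (stage s)
  G : Baire
  G n = pt (suc n) n
  step-≈ : ∀ s → pt s ≈[ len s ] pt (suc s)
  step-≈ s = proj₁ (proj₂ (proj₂ (dense s (pt s) (len s))))
  len-step : ∀ s → suc (len s) ≤ len (suc s)
  len-step s = m≤n⊔m _ (suc (len s))
  len-≥ : ∀ s → s ≤ len s
  len-≥ zero    = z≤n
  len-≥ (suc s) = ≤-trans (s≤s (len-≥ s)) (len-step s)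
  later : ∀ s t → len s ≤ len (t + s) × pt s ≈[ len s ] pt (t + s)
  later s zero    = ≤-refl , ≈-refl
  later s (suc t) = let le , e = later s t in
    ≤-trans le (≤-trans (n≤1+n _) (len-step (t + s))) , ≈-trans e (≈-weaken le (step-≈ (t + s)))
  later′ : ∀ {s t} → s ≤ t → pt s ≈[ len s ] pt t
  later′ {s} {t} s≤t = subst (λ t → pt s ≈[ len s ] pt t) (m∸n+n≡m s≤t) (proj₂ (later s (t ∸ s)))
  limit : ∀ s → pt s ≈[ len s ] G
  limit s n n<len with ≤-total s (suc n)
  ... | inj₁ s≤ = later′ s≤ n n<len
  ... | inj₂ n< = sym (later′ n< n (len-≥ (suc n)))
  meets : ∀ s → R s G
  meets s = proj₂ (proj₂ (proj₂ (dense s (pt s) (len s)))) G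
    (≈-weaken (m≤m⊔n _ (suc (len s))) (limit (suc s)))

col : Baire → ℕ → Baire
col g k n = g (k ⊗ n)

update : Baire → ℕ → ℕ → Baire
update g p v n with n ≟ p
... | yes _ = v
... | no  _ = g n

update-≡ : ∀ g p v → update g p v p ≡ v
update-≡ g p v with p ≟ p
... | yes _  = refl
... | no p≢p = contradiction refl p≢p

update-≢ : ∀ g {p} v {n} → n ≢ p → update g p v n ≡ g n
update-≢ g {p} v {n} n≢p with n ≟ p
... | yes n≡p = contradiction n≡p n≢p
... | no _    = refl

Independent : ℕ → ℕ → ℕ → ℕ → Baire → Set
Independent e k i j G = k ≢ i → k ≢ j → ¬ Φ e at (col G i ⊕ col G j) ↦ col G k

-- If no extension makes program e halt at N, the requirement holds already. Otherwise column k is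
-- changed at N: position `k ⊗ N` is at least N, hence still free, and lies outside columns i and j,
-- so the computation survives.
Independent-dense : EM → ∀ e k i j g N →
  ∃[ g′ ] ∃[ N′ ] (g ≈[ N ] g′ × (∀ h → g′ ≈[ N′ ] h → Independent e k i j h))
Independent-dense em e k i j g N
  with em₀ em (∃[ g′ ] ∃[ v ] (g ≈[ N ] g′ × ((col g′ i ⊕ col g′ j) ⊢ decode e · N ⇓ v)))
... | no diverges = g , N , ≈-refl , λ h g≈h _ _ p → diverges (h , _ , g≈h , p N)
... | yes (g′ , v , g≈g′ , der) with use der
... | L , uses with bounded-sup {λ n S → i ⊗ n < S × j ⊗ n < S} (λ le (a , b) → <-≤-trans a le , <-≤-trans b le) L
                     (λ n _ → suc (i ⊗ n) ⊔ suc (j ⊗ n) , m≤m⊔n (suc (i ⊗ n)) (suc (j ⊗ n)) , m≤n⊔m (suc (i ⊗ n)) (suc (j ⊗ n)))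
... | S , below = g″ , suc p ⊔ S , ≈-trans g≈g′ agree , independent
  where
  p = k ⊗ N
  g″ = update g′ p (suc v)
  agree : g′ ≈[ N ] g″
  agree n n<N = sym (update-≢ g′ (suc v) λ n≡p → <-irrefl refl (<-≤-trans (subst (_< N) n≡p n<N) (⊗-≥ʳ k N)))
  keep : ∀ {l} → k ≢ l → ∀ n → l ⊗ n ≢ p
  keep k≢l n eq = k≢l (sym (proj₁ (⊗-injective eq)))
  independent : ∀ h → g″ ≈[ suc p ⊔ S ] h → Independent e k i j h
  independent h g″≈h k≢i k≢j comp-h = 1+n≢n (trans (sym h-p) h-v)
    where
    col≈ : ∀ {l} → k ≢ l → ∀ n → l ⊗ n < S → col g′ l n ≡ col h l n
    col≈ k≢l n l<S = trans (sym (update-≢ g′ (suc v) (keep k≢l n))) (g″≈h _ (<-≤-trans l<S (m≤n⊔m (suc p) S)))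
    h-p : h p ≡ suc v
    h-p = trans (sym (g″≈h p (m≤m⊔n (suc p) S))) (update-≡ g′ p (suc v))
    h-v : h p ≡ v
    h-v = ⇓-deterministic (λ _ → refl) (comp-h N)
      (uses (col h i ⊕ col h j) λ n n<L → cong₂ _⊗_ (col≈ k≢i n (proj₁ (below n n<L))) (col≈ k≢j n (proj₂ (below n n<L))))

Separated : (u g : ℕ → Baire) → Set
Separated u g =
  (∀ i m i′ → u i′ ≤ᵀ (u i ⊕ g m) → i′ ≡ i) × (∀ i m m′ → g m′ ≤ᵀ (u i ⊕ g m) → m′ ≡ m)

separated-reals : EM → ∃[ u ] ∃[ g ] Separated u g
separated-reals em = let G , meets = generic Req dense in
  (λ i → col G (0 ⊗ i)) , (λ m → col G (1 ⊗ m)) , separated G meets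
  where
  Req : ℕ → Baire → Set
  Req s = Independent (p₁ s) (p₁ (p₂ s)) (p₁ (p₂ (p₂ s))) (p₂ (p₂ (p₂ s)))
  dense : ∀ s g N → ∃[ g′ ] ∃[ N′ ] (g ≈[ N ] g′ × (∀ h → g′ ≈[ N′ ] h → Req s h))
  dense s = Independent-dense em (p₁ s) (p₁ (p₂ s)) (p₁ (p₂ (p₂ s))) (p₂ (p₂ (p₂ s)))
  separated : ∀ G → (∀ s → Req s G) → Separated (λ i → col G (0 ⊗ i)) (λ m → col G (1 ⊗ m))
  separated G meets =
    (λ i m i′ (e , p) → decidable-stable (i′ ≟ i) λ i′≢i →
       meet e (0 ⊗ i′) (0 ⊗ i) (1 ⊗ m) (λ eq → i′≢i (proj₂ (⊗-injective eq))) (λ eq → 0≢1+n (proj₁ (⊗-injective eq))) p) ,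
    (λ i m m′ (e , p) → decidable-stable (m′ ≟ m) λ m′≢m →
       meet e (1 ⊗ m′) (0 ⊗ i) (1 ⊗ m) (λ eq → 1+n≢0 (proj₁ (⊗-injective eq))) (λ eq → m′≢m (proj₂ (⊗-injective eq))) p)
    where
    meet : ∀ e k i j → Independent e k i j G
    meet e k i j with meets (e ⊗ k ⊗ i ⊗ j)
    ... | r rewrite p₁-⊗ e (k ⊗ i ⊗ j) | p₂-⊗ e (k ⊗ i ⊗ j) | p₁-⊗ k (i ⊗ j) | p₂-⊗ k (i ⊗ j)
                  | p₁-⊗ i j | p₂-⊗ i j = r

-- Failure of residuals

≤ᵀ-code : ∀ {x z} c → x ⊩ c ↦ z → z ≤ᵀ x
≤ᵀ-code c p = index c , index↦ c p

≤ᵀ-trans : ∀ {x y z} → z ≤ᵀ y → y ≤ᵀ x → z ≤ᵀ x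
≤ᵀ-trans {x} {y} {z} (e , q) (d , p) = compIndex d e , compIndex↦ {x} {y} {z} {d} {e} p q

⊕-≤ᵀ : ∀ {x y z} → y ≤ᵀ x → z ≤ᵀ x → (y ⊕ z) ≤ᵀ x
⊕-≤ᵀ {x} {y} {z} (d , p) (e , q) = pairIndex d e , pairIndex↦ {x} {y} {z} {d} {e} p q

≤ᵀ-⊕ˡ : ∀ {y z} → y ≤ᵀ (y ⊕ z)
≤ᵀ-⊕ˡ = ≤ᵀ-code (comp fst oracle) (λ n → comp oracle fst⇓)

≤ᵀ-⊕ʳ : ∀ {y z} → z ≤ᵀ (y ⊕ z)
≤ᵀ-⊕ʳ = ≤ᵀ-code (comp snd oracle) (λ n → comp oracle snd⇓)

≤ᵀ-fst : ∀ {z} → (p₁ ∘ z) ≤ᵀ z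
≤ᵀ-fst = ≤ᵀ-code (comp fst oracle) (λ n → comp oracle ft⇓)

≤ᵀ-snd : ∀ {z} → (p₂ ∘ z) ≤ᵀ z
≤ᵀ-snd = ≤ᵀ-code (comp snd oracle) (λ n → comp oracle sd⇓)

infix 4 _=*_
_=*_ : Baire → Baire → Set
f =* h = ∃[ N ] ∀ n → N ≤ n → f n ≡ h n

=*-sym : ∀ {f h} → f =* h → h =* f
=*-sym (N , e) = N , λ n N≤n → sym (e n N≤n)

=*-respˡ : ∀ {f f′ h} → f ≗ f′ → f =* h → f′ =* h
=*-respˡ e (N , eq) = N , λ n N≤n → trans (sym (e n)) (eq n N≤n)

-- Finitely many values are hard-wired: `patch` treats the shifted function and puts `f 0` back by a
-- case distinction on the input.
=*⇒≤ᵀ : ∀ {f h x} → f =* h → h ≤ᵀ x → f ≤ᵀ x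
=*⇒≤ᵀ {x = x} (N , eq) (e , p) = let c , q = patch N eq (decode e) p in ≤ᵀ-code c q
  where
  patch : ∀ N {f h : Baire} → (∀ n → N ≤ n → f n ≡ h n) → ∀ c → x ⊩ c ↦ h → ∃[ c′ ] x ⊩ c′ ↦ f
  patch zero    eq c p = c , λ n → ⇓≡ (p n) (sym (eq n z≤n))
  patch (suc N) {f} eq c p =
    let c′ , q = patch N {λ n → f (suc n)} (λ n N≤n → eq (suc n) (s≤s N≤n)) (comp c succ) (λ n → comp succ (p (suc n)))
    in comp (prec (const (f 0)) (comp c′ (comp fst snd))) (pair zero idc) , λ n →
       comp (pair⇓ zero id⇓)
         (⇓≡ (prec⇓ {s = λ k _ → f (suc k)} (const⇓ (f 0)) (λ k r → comp (comp snd⇓ fst⇓) (q k)) n) (cases f n))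
    where
    cases : ∀ f n → natrec (f 0) (λ k _ → f (suc k)) n ≡ f n
    cases f zero    = refl
    cases f (suc n) = refl

p₁-0 : p₁ 0 ≡ 0
p₁-0 = n≤0⇒n≡0 (subst (p₁ 0 ≤_) (p₁⊗p₂ 0) (subst (p₁ 0 ≤_) (sym (⊗≡⟨,⟩ _ _)) (fst≤pair (p₁ 0) (p₂ 0))))

module Separation {u g : ℕ → Baire} (separated : Separated u g) where

  -- A solution names a pair (i , m) by its degree, and is tagged by ρ i ⊓ m.
  Tagged : (ℕ → ℕ) → Subset
  Tagged ρ = record
    { Member   = λ z → ∃[ i ] ∃[ m ] ((∀ n → p₁ (z n) ≡ ρ i ⊓ m) ×
                   -- Only up to finitely many entries, since in the argument on guesses an opponent
                   -- may prescribe an initial segment unrelated to `u i`.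
                   (p₁ ∘ (p₂ ∘ z)) =* u i × ((p₂ ∘ (p₂ ∘ z)) ≗ g m))
    ; respects = λ { {z} {z′} e (i , m , tag , eq , eq′) → i , m ,
        (λ n → trans (cong p₁ (sym (e n))) (tag n)) ,
        =*-respˡ {p₁ ∘ (p₂ ∘ z)} {p₁ ∘ (p₂ ∘ z′)} (λ n → cong (p₁ ∘ p₂) (e n)) eq ,
        (λ n → trans (cong (p₂ ∘ p₂) (sym (e n))) (eq′ n)) }
    }

  -- A solution computes the two reals that it names; by separation these can only be `u i` and
  -- `g m`.
  tag-of : ∀ {ρ i m z} → z ≤ᵀ (u i ⊕ g m) → z ∈ˢ Tagged ρ → p₁ (z 0) ≡ ρ i ⊓ m
  tag-of {ρ} {i} {m} {z} z≤ (i′ , m′ , tag , z=*u , z≗g)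
    with refl ← proj₁ separated i m i′ (=*⇒≤ᵀ (=*-sym z=*u) (≤ᵀ-trans ≤ᵀ-fst (≤ᵀ-trans ≤ᵀ-snd z≤)))
       | refl ← proj₂ separated i m m′ (=*⇒≤ᵀ (0 , λ n _ → sym (z≗g n)) (≤ᵀ-trans ≤ᵀ-snd (≤ᵀ-trans ≤ᵀ-snd z≤)))
    = tag 0

  -- From g m, the m + 1 constant tags suffice.  But ρ (b ⊗ y) defeats the first
  -- b realizers run on the real that program y computes from g b, so no bound
  -- b serves a set containing a real below every g m.
  module Nonuniform (em : EM) (R : ℕ → Baire → Baire → Set)
    (R-functional : ∀ {e x x′ z z′} → x ≗ x′ → R e x z → R e x′ z′ → z ≗ z′)
    (R⇒≤ᵀ : ∀ {e x z} → R e x z → z ≤ᵀ x)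
    (realize : ∀ c → ∃[ e ] ∀ {x z} → x ⊩ c ↦ z → R e x z)
    where

    A : Subset
    A = record
      { Member   = λ f → ∃[ i ] f ≗ u i
      ; respects = λ { e (i , eq) → i , λ n → trans (sym (e n)) (eq n) }
      }

    -- Some e below p₁ j answers the tag r on u j and the real computed from
    -- g (p₁ j) by program p₂ j.
    Answered : ℕ → ℕ → Set
    Answered j r = ∃[ e ] ∃[ c ] ∃[ z ]
      (e < p₁ j × (Φ (p₂ j) at g (p₁ j) ↦ c) × R e (u j ⊕ c) z × p₁ (z 0) ≡ r)

    -- Otherwise `p₁ j + 1` tags would be answered by `p₁ j` realizers. But a realizer determines
    -- its tag, because program `p₂ j` leaves no choice of c.
    unanswered : ∀ j → ∃[ r ] (r ≤ p₁ j × ¬ Answered j r)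
    unanswered j with em₀ em (∃[ r ] (r ≤ p₁ j × ¬ Answered j r))
    ... | yes found = found
    ... | no  none  = contradiction collision λ { (r , r′ , r<r′ , eq) → <-irrefl (tags-agree r r′ eq) r<r′ }
      where
      answer! : ∀ (r : Fin (suc (p₁ j))) → Answered j (toℕ r)
      answer! r = decidable-stable (em₀ em _) λ un → none (toℕ r , s≤s⁻¹ (toℕ<n r) , un)
      realizer : Fin (suc (p₁ j)) → Fin (p₁ j)
      realizer r = let e , _ , _ , e<b , _ = answer! r in fromℕ< e<b
      collision = pigeonhole ≤-refl realizer
      tags-agree : ∀ r r′ → realizer r ≡ realizer r′ → toℕ r ≡ toℕ r′
      tags-agree r r′ eq with answer! r | answer! r′
      ... | e , c , z , e<b , p , q , t | e′ , c′ , z′ , e′<b , p′ , q′ , t′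
        with refl ← trans (sym (toℕ-fromℕ< e<b)) (trans (cong toℕ eq) (toℕ-fromℕ< e′<b)) =
        trans (sym t) (trans (cong p₁ (R-functional {e} (⊕-cong {u j} (λ _ → refl) (Φ-functional {p₂ j} (λ _ → refl) p p′)) q q′ 0)) t′)

    ρ : ℕ → ℕ
    ρ j = proj₁ (unanswered j)

    solves : ∀ m → ∃[ b ] ∀ x → x ∈ˢ (A ⊗ˢ singleton (g m)) → ∃[ e ] (e < b × Hit (Tagged ρ) (R e x))
    solves m with bounded-sup (λ le lt → <-≤-trans lt le) (suc m)
                    (λ r _ → suc (proj₁ (realize (pair (const r) oracle))) , ≤-refl)
    ... | b , below = b , λ { x ((i , f≗u) , x≗g) →
      proj₁ (realize (pair (const (ρ i ⊓ m)) oracle)) , below (ρ i ⊓ m) (s≤s (m⊓n≤n (ρ i) m)) ,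
      (λ n → (ρ i ⊓ m) ⊗ x n) ,
      proj₂ (realize (pair (const (ρ i ⊓ m)) oracle)) (λ n → pair⇓ (const⇓ (ρ i ⊓ m)) oracle) ,
      i , m , (λ n → p₁-⊗ _ _) ,
      (0 , λ n _ → trans (cong p₁ (p₂-⊗ _ (x n))) (f≗u n)) ,
      (λ n → trans (cong p₂ (p₂-⊗ _ (x n))) (x≗g n)) }

    fails : ∀ C → (∀ m → ∃[ c ] (c ≤ᵀ g m × c ∈ˢ C)) →
            ¬ (∃[ b ] ∀ x → x ∈ˢ (A ⊗ˢ C) → ∃[ e ] (e < b × Hit (Tagged ρ) (R e x)))
    fails C solution (b , h) with solution b
    ... | c , (y , c↤g) , c∈C with h (u (b ⊗ y) ⊕ c) (⊕∈⊗ˢ {A} {C} (b ⊗ y , λ _ → refl) c∈C)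
    ... | e , e<b , z , r , z∈ = proj₂ (proj₂ (unanswered j))
        (e , c , z , subst (e <_) (sym p₁j) e<b , subst₂ (λ d m → Φ d at g m ↦ c) (sym p₂j) (sym p₁j) c↤g , r ,
         -- From `ρ j ≤ b` the cap at b has no effect: the tag is `ρ j` itself, which no realizer
         -- below b answers.
         trans (tag-of z≤ z∈) (m≤n⇒m⊓n≡m (subst (ρ j ≤_) p₁j (proj₁ (proj₂ (unanswered j))))))
      where
      j = b ⊗ y
      p₁j : p₁ j ≡ b
      p₁j = p₁-⊗ b y
      p₂j : p₂ j ≡ y
      p₂j = p₂-⊗ b y
      z≤ : z ≤ᵀ (u j ⊕ g b)
      z≤ = ≤ᵀ-trans (R⇒≤ᵀ {e} r) (⊕-≤ᵀ ≤ᵀ-⊕ˡ (≤ᵀ-trans (y , c↤g) ≤ᵀ-⊕ʳ))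

-- Boundedly many mind changes or guesses

-- Every guess is the initial one or arises at a mind change. Thus one pair of sets serves both
-- notions: few mind changes solve each instance, and even few guesses fail for C.
mindChanges⇒guesses : ∀ {ψ x k} → # MindChange ψ x ≤ k → # Guess ψ x ≤ suc k
mindChanges⇒guesses {ψ} {x} (xs , len , mem) =
  gs ,
  s≤s (subst (_≤ _) (sym (length-map _ xs)) len) ,
  λ { d (n , refl) → guess n }
  where
  gs : List ℕ
  gs = ψ (x ↾ 0) ∷ map (λ n → ψ (x ↾ suc n)) xs
  guess : ∀ n → ψ (x ↾ n) ∈ gs
  guess zero = here refl
  guess (suc n) with ψ (x ↾ suc n) ≟ ψ (x ↾ n)
  ... | yes same    = subst (_∈ gs) (sym same) (guess n)
  ... | no  changed = there (∈-map⁺ (λ n → ψ (x ↾ suc n)) (mem n changed))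

monotone : ∀ {s : ℕ → ℕ} → (∀ n → s n ≤ s (suc n)) → ∀ {m n} → m ≤ n → s m ≤ s n
monotone {s} mono {m} {n} m≤n = subst (λ n → s m ≤ s n) (m∸n+n≡m m≤n) (go (n ∸ m))
  where
  go : ∀ k → s m ≤ s (k + m)
  go zero    = ≤-refl
  go (suc k) = ≤-trans (go k) (mono (k + m))

-- A change at n is charged to the level `s n`, and each level below K is crossed only once. A level
-- that is never crossed contributes the filler 0.
monotone-changes : EM → ∀ {s : ℕ → ℕ} {K} → (∀ n → s n ≤ s (suc n)) → (∀ n → s n ≤ K) →
                   # (λ n → s (suc n) ≢ s n) ≤ K
monotone-changes em {s} {K} mono bound =
  applyUpTo crossing K , ≤-reflexive (length-applyUpTo crossing K) , member
  where
  Crosses : ℕ → ℕ → Set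
  Crosses j n = s n ≤ j × j < s (suc n)
  find : ∀ {j} → Dec (∃[ n ] Crosses j n) → ℕ
  find (yes (n , _)) = n
  find (no _)        = 0
  crossing : ℕ → ℕ
  crossing j = find (em₀ em (∃[ n ] Crosses j n))
  unique : ∀ {j m n} → Crosses j m → Crosses j n → m ≡ n
  unique {j} {m} {n} (sm≤j , j<s) (sn≤j , j<s′) with <-cmp m n
  ... | tri< m<n _ _ = contradiction (<-≤-trans j<s (≤-trans (monotone mono m<n) sn≤j)) (<-irrefl refl)
  ... | tri≈ _ m≡n _ = m≡n
  ... | tri> _ _ n<m = contradiction (<-≤-trans j<s′ (≤-trans (monotone mono n<m) sm≤j)) (<-irrefl refl)
  member : ∀ n → s (suc n) ≢ s n → n ∈ applyUpTo crossing K
  member n changed = subst (_∈ applyUpTo crossing K) (found (em₀ em _)) (∈-applyUpTo⁺ crossing {i = s n} (<-≤-trans increase (bound (suc n))))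
    where
    increase : s n < s (suc n)
    increase = ≤∧≢⇒< (mono n) (changed ∘ sym)
    found : (d : Dec (∃[ m ] Crosses (s n) m)) → find d ≡ n
    found (yes (m , c)) = unique c (≤-refl , increase)
    found (no none)     = contradiction (n , ≤-refl , increase) none

splice : Baire → ℕ → Baire → Baire
splice f N h n with n <? N
... | yes _ = f n
... | no  _ = h n

splice-< : ∀ f {N} h {n} → n < N → splice f N h n ≡ f n
splice-< f {N} h {n} n<N with n <? N
... | yes _   = refl
... | no  n≮N = contradiction n<N n≮N

splice-≥ : ∀ f {N} h {n} → N ≤ n → splice f N h n ≡ h n
splice-≥ f {N} h {n} N≤n with n <? N
... | yes n<N = contradiction N≤n (<⇒≱ n<N)
... | no  _   = refl

-- Once m is known, the label capped at m changes at most m times.  An opponent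
-- who waits for a correct guess before raising the label forces k + 1 guesses.
module FewGuesses {u g : ℕ → Baire} (separated : Separated u g) where
  open Separation separated

  labelled : ℕ → Baire
  labelled i n = i ⊗ u i n

  Rising : Baire → Set
  Rising f = ∀ n → p₁ (f n) ≤ p₁ (f (suc n))

  A : Subset
  A = record
    { Member   = λ f → Rising f × (∃[ i ] f =* labelled i)
    ; respects = λ { {f} {f′} e (rise , i , eq) →
        (λ n → subst₂ (λ a b → p₁ a ≤ p₁ b) (e n) (e (suc n)) (rise n)) , i , =*-respˡ {f} {f′} e eq }
    }

  B : Subset
  B = Tagged (λ i → i)

  -- Input r ⊗ n: the n-th entry of the solution tagged r.
  tagger : Exp 1
  tagger = ft #0 ⊗ᵉ sd (ft (orc (sd #0))) ⊗ᵉ sd (orc (sd #0))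

  module Solves (em : EM) (m : ℕ) where

    X : Subset
    X = A ⊗ˢ singleton (g m)

    -- The minimum of m and the label, in terms of the truncated subtraction of `Exp`.
    tag : ℕ → ℕ
    tag v = p₁ (p₁ v) ∸ (p₁ (p₁ v) ∸ m)

    tag≡ : ∀ v → tag v ≡ p₁ (p₁ v) ⊓ m
    tag≡ v = trans (cong (_∸ (t ∸ m)) (sym (m⊓n+n∸m≡n m t))) (trans (m+n∸n≡m (m ⊓ t) (t ∸ m)) (⊓-comm m t))
      where t = p₁ (p₁ v)

    guess : ℕ → ℕ
    guess v = specIndex (fn tagger) (tag v)

    ψ : List ℕ → ℕ
    ψ = lastLearner guess

    ψ-Learner : Learner ψ
    ψ-Learner = lastLearner-Learner guess
      (specIndexᵉ (fn tagger) (ft (ft #0) ∸ᵉ (ft (ft #0) ∸ᵉ lit m)))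
      (λ h n → trans (eval-specIndexᵉ (fn tagger) (ft (ft #0) ∸ᵉ (ft (ft #0) ∸ᵉ lit m)) h (n ∷ []))
        (cong (λ k → specIndex (fn tagger) (p₁ (p₁ n) ∸ (p₁ (p₁ n) ∸ k))) (eval-lit m h (n ∷ []))))

    reduces : ∀ x → x ∈ˢ X → ∃[ d ] (Lim ψ x d × Hit B (λ z → Φ d at x ↦ z))
    reduces x ((rise , i , N , eq) , x≗g) = specIndex (fn tagger) (i ⊓ m) , (suc N , limit) ,
      (λ n → (i ⊓ m) ⊗ p₂ (p₁ (x n)) ⊗ p₂ (x n)) ,
      index↦ (spec (fn tagger) (i ⊓ m)) (λ n → spec⇓ (⇓≡ (fn⇓ tagger ((i ⊓ m) ⊗ n)) (tagged n))) ,
      i , m , (λ n → p₁-⊗ _ _) ,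
      (N , λ n N≤n → trans (cong p₁ (p₂-⊗ _ _)) (trans (p₁-⊗ _ _) (trans (cong p₂ (eq n N≤n)) (p₂-⊗ _ _)))) ,
      (λ n → trans (cong p₂ (p₂-⊗ _ _)) (trans (p₂-⊗ _ _) (x≗g n)))
      where
      tagged : ∀ n → eval tagger x ((i ⊓ m) ⊗ n ∷ []) ≡ (i ⊓ m) ⊗ p₂ (p₁ (x n)) ⊗ p₂ (x n)
      tagged n rewrite p₁-⊗ (i ⊓ m) n | p₂-⊗ (i ⊓ m) n = refl
      limit : ∀ n → suc N ≤ n → ψ (x ↾ n) ≡ specIndex (fn tagger) (i ⊓ m)
      limit (suc n) (s≤s N≤n) = cong (specIndex (fn tagger)) (trans (cong tag (lastℕ-↾ x n))
        (trans (tag≡ (x n)) (cong (_⊓ m) (trans (cong p₁ (eq n N≤n)) (p₁-⊗ i _)))))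

    current : Baire → ℕ → ℕ
    current x n = tag (lastℕ (encodeString (x ↾ n)))

    tag≤m : ∀ v → tag v ≤ m
    tag≤m v = subst (_≤ m) (sym (tag≡ v)) (m⊓n≤n _ m)

    current-rising : ∀ x → x ∈ˢ X → ∀ n → current x n ≤ current x (suc n)
    -- On the empty prefix the last entry defaults to 0, whose tag is 0; so the sequence cannot drop
    -- at its start.
    current-rising x _ zero = subst (_≤ current x 1) (sym tag-0) z≤n
      where
      tag-0 : tag 0 ≡ 0
      tag-0 = trans (tag≡ 0) (cong (_⊓ m) (trans (cong p₁ p₁-0) p₁-0))
    current-rising x ((rise , _) , _) (suc n) =
      subst₂ _≤_ (sym (at n)) (sym (at (suc n))) (⊓-monoˡ-≤ m (rise n))
      where
      at : ∀ n → current x (suc n) ≡ p₁ (p₁ (x n)) ⊓ m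
      at n = trans (cong tag (lastℕ-↾ x n)) (tag≡ (x n))

    mindChanges : ∀ x → x ∈ˢ X → # MindChange ψ x ≤ m
    mindChanges x x∈X with monotone-changes em (current-rising x x∈X) (λ n → tag≤m _)
    ... | xs , len , mem = xs , len , λ n changed → mem n (λ same → changed (cong (specIndex (fn tagger)) same))

  module Fails {C : Subset} {k : ℕ} (ψ : List ℕ → ℕ)
    (reduces : ∀ x → x ∈ˢ (A ⊗ˢ C) → ∃[ d ] (Lim ψ x d × Hit B (λ z → Φ d at x ↦ z)))
    (bound : ∀ x → x ∈ˢ (A ⊗ˢ C) → # Guess ψ x ≤ k)
    {c : Baire} (c≤g : c ≤ᵀ g k) (c∈C : c ∈ˢ C)
    where

    Guessed : Baire → ℕ → ℕ → Set
    Guessed f j d = Guess ψ (f ⊕ c) d × (∃[ w ] ((f ⊕ c) ⊢ decode d · 0 ⇓ w × p₁ w ≡ j))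

    -- After i rounds the condition (f , N) forces guesses with the tags below i.
    Round : ℕ → Set
    Round i = ∃[ f ] ∃[ N ] (Rising f × (∀ n → p₁ (f n) ≤ i) ×
      (∀ j → j < i → ∃[ d ] ∀ f′ → f ≈[ N ] f′ → Guessed f′ j d))

    module _ {i : ℕ} {f : Baire} (N : ℕ) (rise : Rising f) (f≤i : ∀ n → p₁ (f n) ≤ i) where

      follow : Baire
      follow = splice f N (labelled i)

      follow≤ : ∀ n → p₁ (follow n) ≤ i
      follow≤ n with n <? N
      ... | yes _ = f≤i n
      ... | no  _ = ≤-reflexive (p₁-⊗ i _)

      follow∈A : follow ∈ˢ A
      follow∈A = rising , i , N , λ n N≤n → splice-≥ f (labelled i) N≤n
        where
        rising : Rising follow
        rising n with suc n <? N
        ... | yes sn<N = subst (λ v → p₁ v ≤ p₁ (f (suc n))) (sym (splice-< f (labelled i) (<-trans (n<1+n n) sn<N))) (rise n)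
        ... | no  _    = subst (p₁ (follow n) ≤_) (sym (p₁-⊗ i _)) (follow≤ n)

      f≈follow : f ≈[ N ] follow
      f≈follow n n<N = sym (splice-< f (labelled i) n<N)

      follow≤ᵀ : (follow ⊕ c) ≤ᵀ (u i ⊕ g k)
      follow≤ᵀ = ⊕-≤ᵀ
        (=*⇒≤ᵀ (proj₂ (proj₂ follow∈A)) (≤ᵀ-code (pair (const i) (comp fst oracle))
          (λ n → pair⇓ (const⇓ i) (comp oracle fst⇓))))
        (≤ᵀ-trans c≤g ≤ᵀ-⊕ʳ)

    -- Let f continue with label i. As i is at most k, the only admissible tag is `i ⊓ k = i`, so
    -- the limit guess outputs it. Freezing the prefix that shows this guess, together with the use
    -- of its first output, keeps both in all later rounds.
    next : ∀ {i} → i ≤ k → Round i → Round (suc i)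
    next {i} i≤k (f , N , rise , f≤i , forced) with reduces (follow N rise f≤i ⊕ c) (⊕∈⊗ˢ {A} {C} (follow∈A N rise f≤i) c∈C)
    ... | d , (n₀ , lim) , z , d↦z , z∈B with use (d↦z 0)
    ... | L , uses =
      h , N ⊔ (L ⊔ n₀) , proj₁ (follow∈A N rise f≤i) , (λ n → m≤n⇒m≤1+n (follow≤ N rise f≤i n)) , forced′
      where
      h = follow N rise f≤i
      tag : p₁ (z 0) ≡ i
      tag = trans (tag-of {λ i → i} {i} {k} {z} (≤ᵀ-trans (d , d↦z) (follow≤ᵀ N rise f≤i)) z∈B) (m≤n⇒m⊓n≡m i≤k)
      forced′ : ∀ j → j < suc i → ∃[ d ] ∀ f′ → h ≈[ N ⊔ (L ⊔ n₀) ] f′ → Guessed f′ j d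
      forced′ j j<si with m≤n⇒m<n∨m≡n (s≤s⁻¹ j<si)
      ... | inj₁ j<i = let d , g = forced j j<i in d , λ f′ h≈f′ →
        g f′ (≈-trans (f≈follow N rise f≤i) (≈-weaken (m≤m⊔n N _) h≈f′))
      ... | inj₂ refl = d , λ f′ h≈f′ →
        let Ln≈ = ≈-weaken (m≤n⊔m N (L ⊔ n₀)) h≈f′
            joined : ∀ {M} → M ≤ L ⊔ n₀ → (h ⊕ c) ≈[ M ] (f′ ⊕ c)
            joined le n n<M = cong (_⊗ c n) (Ln≈ n (<-≤-trans n<M le))
        in (n₀ , trans (cong ψ (sym (applyUpTo-≈ n₀ (joined (m≤n⊔m L n₀))))) (lim n₀ ≤-refl)) ,
           z 0 , uses (f′ ⊕ c) (joined (m≤m⊔n L n₀)) , tag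

    rounds : ∀ i → i ≤ suc k → Round i
    rounds zero    _    = (λ _ → 0 ⊗ 0) , 0 , (λ n → ≤-refl) , (λ n → ≤-reflexive (p₁-⊗ 0 0)) , λ _ ()
    rounds (suc i) i<sk = next (s≤s⁻¹ i<sk) (rounds i (<⇒≤ i<sk))

    -- On one member of A the tags 0 to k are all forced. A guess determines its first output and so
    -- its tag; these are k + 1 different guesses.
    impossible : ⊥
    impossible with rounds (suc k) ≤-refl
    ... | f , N , rise , f≤ , forced with bound (follow N rise f≤ ⊕ c) (⊕∈⊗ˢ {A} {C} (follow∈A N rise f≤) c∈C)
    ... | xs , len , mem = let r , r′ , r<r′ , eq = pigeonhole (s≤s len) position in <-irrefl (agree r r′ eq) r<r′
      where
      h = follow N rise f≤
      guessed : (r : Fin (suc k)) → ∃[ d ] Guessed h (toℕ r) d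
      guessed r = let d , g = forced (toℕ r) (toℕ<n r) in d , g h (f≈follow N rise f≤)
      listed : (r : Fin (suc k)) → proj₁ (guessed r) ∈ xs
      listed r = mem _ (proj₁ (proj₂ (guessed r)))
      position : Fin (suc k) → Fin (length xs)
      position r = Any.index (listed r)
      agree : ∀ r r′ → position r ≡ position r′ → toℕ r ≡ toℕ r′
      agree r r′ eq = let d , _ , w , p , t = guessed r
                          d′ , _ , w′ , p′ , t′ = guessed r′
                          d≡d′ = trans (lookup-index (listed r)) (trans (cong (List.lookup xs) eq) (sym (lookup-index (listed r′))))
        in trans (sym t) (trans (cong p₁ (⇓-deterministic (λ _ → refl) p (subst (λ d → (h ⊕ c) ⊢ decode d · 0 ⇓ w′) (sym d≡d′) p′))) t′)

separates : EM → ∀ {ν} → ν ∈ (⟨1,<ω⟩ ∷ ⟨1,ω|<ω⟩ ∷ ⟨<ω,1⟩ ∷ ⟨<ω,ω⟩ ∷ []) → ¬ (𝓓 ν ⊨ brouwerian)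
separates em ν∈ with separated-reals em
separates em (here refl) | u , g , separated =
  ⊭-brouwerian em ⟨1,<ω⟩ A B g
    (λ m → let open Solves em m in ψ , ψ-Learner , reduces , m , mindChanges)
    -- k mind changes allow k + 1 guesses, hence the member below `g (suc k)`.
    (λ { C solution (ψ , _ , reduces , k , changes) → let c , c≤g , c∈C = solution (suc k) in
         Fails.impossible {C} {suc k} ψ reduces (λ x x∈ → mindChanges⇒guesses {ψ} {x} (changes x x∈)) c≤g c∈C })
  where open FewGuesses separated
separates em (there (here refl)) | u , g , separated =
  ⊭-brouwerian em ⟨1,ω|<ω⟩ A B g
    (λ m → let open Solves em m in ψ , ψ-Learner , reduces , suc m , λ x x∈ → mindChanges⇒guesses {ψ} {x} (mindChanges x x∈))
    (λ { C solution (ψ , _ , reduces , k , guesses) → let c , c≤g , c∈C = solution k in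
         Fails.impossible {C} {k} ψ reduces guesses c≤g c∈C })
  where open FewGuesses separated
separates em (there (there (here refl))) | u , g , separated =
  ⊭-brouwerian em ⟨<ω,1⟩ A (Tagged ρ) g solves fails
  where
  open Separation separated
  open Nonuniform em (λ e x z → Φ e at x ↦ z) (λ {e} → Φ-functional {e}) (λ {e} p → e , p)
    (λ c → index c , index↦ c)
separates em (there (there (there (here refl)))) | u , g , separated =
  ⊭-brouwerian em ⟨<ω,ω⟩ A (Tagged ρ) g solves fails
  where
  open Separation separated
  learned⇒≤ᵀ : ∀ {e x z} → LearnBy e x z → z ≤ᵀ x
  learned⇒≤ᵀ (_ , _ , d , _ , p) = d , p
  realize : ∀ c → ∃[ e ] ∀ {x z} → x ⊩ c ↦ z → LearnBy e x z
  realize c = index (const (index c)) , λ p → (λ _ → index c) ,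
    (λ σ → index⇓ (const (index c)) (const⇓ (index c))) , index c , (0 , λ _ _ → refl) , index↦ c p
  open Nonuniform em LearnBy (λ {e} → LearnBy-functional {e}) (λ {e} → learned⇒≤ᵀ {e}) realize

corollary87 : ExcludedMiddle (lsuc 0ℓ) → ∀ {αβ γδ : Notion} →
    αβ ∈ (⟨1,1⟩ ∷ ⟨1,ω⟩ ∷ ⟨ω,1⟩ ∷ []) →
    γδ ∈ (⟨1,<ω⟩ ∷ ⟨1,ω|<ω⟩ ∷ ⟨<ω,1⟩ ∷ ⟨<ω,ω⟩ ∷ []) →
    ElementarilyDifferent (𝓓 αβ) (𝓓 γδ)
corollary87 em αβ∈ γδ∈ = brouwerian , inj₁ (Brouwerian⇒⊨ em (cases αβ∈) , separates em γδ∈)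
  where
  cases : ∀ {ν} → ν ∈ (⟨1,1⟩ ∷ ⟨1,ω⟩ ∷ ⟨ω,1⟩ ∷ []) → Brouwerian ν
  cases (here refl)                 = ⟨1,1⟩
  cases (there (here refl))         = ⟨1,ω⟩
  cases (there (there (here refl))) = ⟨ω,1⟩
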